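{- Let $\mathcal B$ be a binomial class of reluctant functions with counting polynomials $(p_n(x))_{n\ge0}$, and suppose $(p_n(x))_{n\ge0}$ is the basic sequence of a delta operator $\mathfrak d$ on $\mathbb Q[x]$. Let $n\in\mathbb N$, $x$ a positive integer, $X=\{1,\dots,x\}$, $S=\{s_0,\dots,s_{n-1}\}$, and let $\mathcal Z=(z_0,z_1,\dots)$ be a sequence of numbers with $z_0\le z_1\le\cdots\le z_{n-1}$ integers in $X$. Then $$ord(z_0,\dots,z_{n-1})=t_n\big(x;\mathfrak d,(x-z_i)_{i\ge0}\big)=t_n(0;\mathfrak d,-\mathcal Z),$$ i.e. $t_n(0;\mathfrak d,-\mathcal Z)$ counts the reluctant functions of $\mathcal B$ from $S$ to $X$ whose order statistics are bounded by $\mathcal Z$.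
   Context: For finite disjoint sets $S$ and $X$, a reluctant function from $S$ to $X$ is a map $f:S\to S\cup X$ such that for every $s\in S$ there is a positive integer $k$ with $f^k(s)\in X$; this element is the final image of $s$. A binomial class $\mathcal B$ assigns to every pair of finite disjoint sets $(S,X)$ a set $F(S,X)$ of reluctant functions from $S$ to $X$, compatibly with bijections of $S$ and of $X$, such that for disjoint $X,Y$ the map $f\mapsto(f_A,f_{S\setminus A})$, where $A$ is the set of elements of $S$ whose final image lies in $X$ and $f_A,f_{S\setminus A}$ are the restrictions, is a bijection from $F(S,X\cup Y)$ onto $\bigsqcup_{A\subseteq S}F(A,X)\times F(S\setminus A,Y)$. Writing $p_n(x)=|F(S,X)|$ when $|S|=n$, $|X|=x$, this is a polynomial in $x$ of degree $n$. For $f\in F(S,X)$, let $x_j$ be the final image of $s_j$ and $x_{(0)}\le\cdots\le x_{(n-1)}$ the non-decreasing rearrangement; $ord(z_0,\dots,z_{n-1})$ is the number of $f\in F(S,X)$ with $x_{(j)}\le z_j$ for all $j$. A delta operator on $\mathbb Q[x]$ is a linear operator commuting with all shifts $g(x)\mapsto g(x+a)$ and sending $x$ to a nonzero constant; its basic sequence is the unique polynomial sequence $(p_n)$ with $p_0=1$, $p_n(0)=0$ for $n\ge1$, $\mathfrak d p_n=np_{n-1}$. For a sequence $\mathcal W=(w_i)_{i\ge0}$, $t_n(y;\mathfrak d,\mathcal W)$ is the $n$-th term of the unique sequence of polynomials $(t_n)_{n\ge0}$ with $\deg t_n=n$ and $(\mathfrak d^i t_n)(w_i)=n!\,\delta_{i,n}$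 for all $i,n$; $-\mathcal Z=(-z_i)_{i\ge0}$. -}

module Defs where

open import Data.Bool using (Bool; true; false; _∧_; not; if_then_else_; T)
open import Data.Nat as ℕ using (ℕ; zero; suc; _≡ᵇ_; _<_; _≤_)
open import Data.Nat.Properties as ℕP using ()
open import Data.Nat using (_!)
open import Data.Integer using (+_)
open import Data.Rational as ℚ using (ℚ; 0ℚ; 1ℚ; _/_; _≤ᵇ_)
open import Data.List using (List; []; _∷_; _++_; length; map; concatMap; upTo)
open import Data.Bool.ListAction using (any)
open import Data.List.Membership.Propositional using (_∈_)
open import Data.List.Relation.Unary.All using (All)
open import Data.List.Relation.Unary.Linked using (Linked)
open import Data.Product using (Σ; ∃; ∃-syntax; _×_; _,_)
open import Data.Sum using (_⊎_)
open import Data.Empty using (⊥)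
open import Function.Bundles using (_↔_; _⇔_; Inverse)
open import Relation.Binary.PropositionalEquality using (_≡_; _≢_)
open import Data.List.Sort ℕP.≤-decTotalOrder using (sort)

-- Finite sets of labels.
-- A finite set is represented canonically by a strictly increasing list of
-- natural numbers (so set equality is list equality).

IsFinSet : List ℕ → Set
IsFinSet S = Linked _<_ S

Disjoint : List ℕ → List ℕ → Set
Disjoint S X = ∀ e → e ∈ S → e ∈ X → ⊥

IsUnion : List ℕ → List ℕ → List ℕ → Set
IsUnion X Y Z = ∀ e → (e ∈ Z) ⇔ (e ∈ X ⊎ e ∈ Y)

IsImage : (ℕ ↔ ℕ) → List ℕ → List ℕ → Set
IsImage ρ S S' = ∀ e → (e ∈ S') ⇔ (∃[ s ] (s ∈ S × Inverse.to ρ s ≡ e))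

_∈ᵇ_ : ℕ → List ℕ → Bool
e ∈ᵇ X = any (e ≡ᵇ_) X

filterᵇ : {A : Set} → (A → Bool) → List A → List A
filterᵇ P [] = []
filterᵇ P (a ∷ as) = if P a then a ∷ filterᵇ P as else filterᵇ P as

-- Maps f : S → S ∪ X are represented by the list of images aligned with S
-- (the i-th entry of f is the image of the i-th element of S).

app : List ℕ → List ℕ → ℕ → ℕ
app [] f e = e
app (s ∷ S) [] e = e
app (s ∷ S) (v ∷ f) e = if e ≡ᵇ s then v else app S f e

iter : ℕ → (ℕ → ℕ) → ℕ → ℕ
iter zero g e = e
iter (suc k) g e = g (iter k g e)

IsReluctant : List ℕ → List ℕ → List ℕ → Set
IsReluctant S X f =
  length f ≡ length S
  × All (λ y → y ∈ S ⊎ y ∈ X) f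
  × (∀ s → s ∈ S → ∃[ k ] (1 ≤ k × iter k (app S f) s ∈ X))

-- final image of s: the first element of X on the orbit of s.  Since app is
-- the identity outside S and an orbit visits at most |S| elements of S
-- before reaching X, this is the |S|-th iterate.
finalImage : List ℕ → List ℕ → ℕ → ℕ
finalImage S f s = iter (length S) (app S f) s

cands : ℕ → List ℕ → List (List ℕ)
cands zero V = [] ∷ []
cands (suc n) V = concatMap (λ v → map (v ∷_) (cands n V)) V

restrict : List ℕ → List ℕ → List ℕ → List ℕ
restrict S f A = map (app S f) A

glue : (ℕ → Bool) → List ℕ → List ℕ → List ℕ → List ℕ
glue m S g h =
  map (λ s → if m s then app (filterᵇ m S) g s else app (filterᵇ (λ u → not (m u)) S) h s) S

transport : (ℕ ↔ ℕ) → List ℕ → List ℕ → List ℕ → List ℕ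
transport ρ S S' f = map (λ s' → Inverse.to ρ (app S f (Inverse.from ρ s'))) S'

-- Binomial classes of reluctant functions.
-- F S X f = true  means  f ∈ F(S,X)  (membership in a subset of the finite
-- set of all maps S → S ∪ X is represented as a Boolean predicate).

record BinomialClass : Set where
  field
    F : List ℕ → List ℕ → List ℕ → Bool
    F-reluctant : ∀ S X f → IsFinSet S → IsFinSet X → Disjoint S X →
      T (F S X f) → IsReluctant S X f
    -- compatibility with bijections of S and of X (any pair of bijections
    -- S → S', X → X' extends to a permutation ρ of ℕ)
    F-bij : ∀ (ρ : ℕ ↔ ℕ) S X S' X' → IsFinSet S → IsFinSet X → IsFinSet S' → IsFinSet X' →
      Disjoint S X → IsImage ρ S S' → IsImage ρ X X' →
      ∀ f → length f ≡ length S → F S X f ≡ F S' X' (transport ρ S S' f)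
    -- the binomial bijection, part 1: f ↦ (f_A, f_{S\A}) lands in the disjoint union
    F-split : ∀ S X Y Z → IsFinSet S → IsFinSet X → IsFinSet Y → IsFinSet Z →
      Disjoint S X → Disjoint S Y → Disjoint X Y → IsUnion X Y Z →
      ∀ f → T (F S Z f) →
      T (F (filterᵇ (λ s → finalImage S f s ∈ᵇ X) S) X
           (restrict S f (filterᵇ (λ s → finalImage S f s ∈ᵇ X) S)))
      × T (F (filterᵇ (λ s → not (finalImage S f s ∈ᵇ X)) S) Y
           (restrict S f (filterᵇ (λ s → not (finalImage S f s ∈ᵇ X)) S)))
    -- part 2: surjectivity (injectivity is automatic, f being determined by
    -- its restrictions)
    F-glue : ∀ S X Y Z → IsFinSet S → IsFinSet X → IsFinSet Y → IsFinSet Z →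
      Disjoint S X → Disjoint S Y → Disjoint X Y → IsUnion X Y Z →
      ∀ (m : ℕ → Bool) g h →
      T (F (filterᵇ m S) X g) → T (F (filterᵇ (λ s → not (m s)) S) Y h) →
      T (F S Z (glue m S g h))

open BinomialClass public

ℕ→ℚ : ℕ → ℚ
ℕ→ℚ n = + n / 1

count : BinomialClass → List ℕ → List ℕ → ℕ
count B S X = length (filterᵇ (F B S X) (cands (length S) (S ++ X)))

boundedFrom : List ℕ → (ℕ → ℚ) → ℕ → Bool
boundedFrom [] z i = true
boundedFrom (a ∷ as) z i = (ℕ→ℚ a ≤ᵇ z i) ∧ boundedFrom as z (suc i)

orderStats : List ℕ → List ℕ → List ℕ
orderStats S f = sort (map (finalImage S f) S)

ord : BinomialClass → List ℕ → List ℕ → (ℕ → ℚ) → ℕ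
ord B S X z =
  length (filterᵇ (λ f → F B S X f ∧ boundedFrom (orderStats S f) z 0)
                  (cands (length S) (S ++ X)))

-- Polynomials over ℚ as coefficient lists (constant term first);
-- equality is coefficient-wise (trailing zeros ignored).

Poly : Set
Poly = List ℚ

coeff : Poly → ℕ → ℚ
coeff [] k = 0ℚ
coeff (c ∷ p) zero = c
coeff (c ∷ p) (suc k) = coeff p k

infix 4 _≈ₚ_
_≈ₚ_ : Poly → Poly → Set
p ≈ₚ q = ∀ k → coeff p k ≡ coeff q k

_+ₚ_ : Poly → Poly → Poly
[] +ₚ q = q
(c ∷ p) +ₚ [] = c ∷ p
(c ∷ p) +ₚ (d ∷ q) = (c ℚ.+ d) ∷ (p +ₚ q)

_·ₚ_ : ℚ → Poly → Poly
a ·ₚ p = map (a ℚ.*_) p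

eval : Poly → ℚ → ℚ
eval [] r = 0ℚ
eval (c ∷ p) r = c ℚ.+ r ℚ.* eval p r

linMul : ℚ → Poly → Poly
linMul a q = (0ℚ ∷ q) +ₚ (a ·ₚ q)

shift : ℚ → Poly → Poly
shift a [] = []
shift a (c ∷ p) = (c ∷ []) +ₚ linMul a (shift a p)

xₚ : Poly
xₚ = 0ℚ ∷ 1ℚ ∷ []

HasDegree : Poly → ℕ → Set
HasDegree p n = coeff p n ≢ 0ℚ × (∀ k → n < k → coeff p k ≡ 0ℚ)

record DeltaOperator : Set where
  field
    D : Poly → Poly
    D-cong : ∀ p q → p ≈ₚ q → D p ≈ₚ D q
    D-+ : ∀ p q → D (p +ₚ q) ≈ₚ D p +ₚ D q
    D-· : ∀ a p → D (a ·ₚ p) ≈ₚ a ·ₚ D p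
    D-shift : ∀ a p → D (shift a p) ≈ₚ shift a (D p)
    D-x : ∃[ c ] (c ≢ 0ℚ × D xₚ ≈ₚ c ∷ [])

open DeltaOperator public

Dpow : DeltaOperator → ℕ → Poly → Poly
Dpow 𝔡 zero p = p
Dpow 𝔡 (suc i) p = D 𝔡 (Dpow 𝔡 i p)

IsBasicSequence : DeltaOperator → (ℕ → Poly) → Set
IsBasicSequence 𝔡 p =
  (∀ n → HasDegree (p n) n)
  × p 0 ≈ₚ 1ℚ ∷ []
  × (∀ n → eval (p (suc n)) 0ℚ ≡ 0ℚ)
  × (∀ n → D 𝔡 (p (suc n)) ≈ₚ ℕ→ℚ (suc n) ·ₚ p n)

IsT : DeltaOperator → (ℕ → ℚ) → ℕ → Poly → Set
IsT 𝔡 w n t =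
  HasDegree t n
  × (∀ i → eval (Dpow 𝔡 i t) (w i) ≡ (if i ≡ᵇ n then ℕ→ℚ (n !) else 0ℚ))

HasCountingPolys : BinomialClass → (ℕ → Poly) → Set
HasCountingPolys B p = ∀ S X → IsFinSet S → IsFinSet X → Disjoint S X →
  ℕ→ℚ (count B S X) ≡ eval (p (length S)) (ℕ→ℚ (length X))

interval : ℕ → List ℕ
interval x = map suc (upTo x)

{-# OPTIONS --safe #-}

-- Fix f ∈ F(S,X), and let A be the set of elements of S whose final image is at most z_j, where
-- j is the least index with x_(j) > z_j (and A = S if there is none).  Then |A| = j, and the
-- binomial bijection for X = {1,…,z_j} ∪ {z_j+1,…,x} turns f into a map on A whose order
-- statistics obey the bounds together with an arbitrary map from S∖A to {z_j+1,…,x}.  Hence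
--   p_n(x) = Σ_{A ⊆ S} p_{n-|A|}(x - z_|A|) ord(z_0,…,z_{|A|-1}),
-- which determines the numbers ord recursively.  On the other side, 𝔡^i p_n = n!/(n-i)! p_{n-i},
-- so any numbers G_i satisfying that recursion satisfy q(x) = Σ_i (𝔡^i q)(x - z_i) G_i / i! for
-- q = p_n, hence for every polynomial q; for q = t_n the right-hand side is G_n.  The second
-- formula follows by shifting t_n by x.
module Submission where

open import Defs
open import Data.Nat using (ℕ; suc; _≤_; _<_)
open import Data.Rational using (ℚ; 0ℚ; _-_; -_) renaming (_≤_ to _≤ℚ_)
open import Data.List using (List; length)
open import Data.Product using (∃-syntax; _×_)
open import Relation.Binary.PropositionalEquality using (_≡_)

open import Data.Bool using (Bool; true; false; _∧_; not; if_then_else_; T)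
open import Data.Bool.Properties using (T?; T-≡; T-not-≡; T-∧)
open import Data.Empty using (⊥; ⊥-elim)
open import Data.Fin using (Fin; toℕ)
import Data.Fin.Properties as Fin
import Data.Integer as ℤ
import Data.Integer.Properties as ℤ
open import Data.List using ([]; _∷_; _++_; map; concatMap; filter; upTo; applyUpTo)
open import Data.List.Membership.Propositional using (_∈_; _∉_)
open import Data.List.Membership.Propositional.Properties
  using ( ∈-filter⁺; ∈-filter⁻; ∈-map⁺; ∈-map⁻; ∈-++⁺ˡ; ∈-++⁺ʳ; ∈-++⁻; ∈-concatMap⁺; ∈-upTo⁺; ∈-upTo⁻
        ; ∈-applyUpTo⁺; ∈-applyUpTo⁻)
open import Data.List.Membership.Propositional.Properties.WithK using (unique∧set⇒bag)
open import Data.List.Membership.Setoid.Properties using (index-injective)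
open import Data.List.Properties
  using ( length-++; length-map; length-filter; length-applyUpTo; filter-all; filter-none
        ; map-cong-local; ∷-injective)
open import Data.List.Relation.Binary.BagAndSetEquality using (∼bag⇒↭)
open import Data.List.Relation.Binary.Permutation.Propositional using (_↭_)
open import Data.List.Relation.Binary.Permutation.Propositional.Properties using (↭-length; filter-↭)
open import Data.List.Relation.Unary.All as All using (All; []; _∷_)
open import Data.List.Relation.Unary.All.Properties using (All¬⇒¬Any)
open import Data.List.Relation.Unary.AllPairs as AllPairs using ([]; _∷_)
open import Data.List.Relation.Unary.Any as Any using (here; there; index)
open import Data.List.Relation.Unary.Any.Properties using (any⁺; any⁻)
open import Data.List.Relation.Unary.Linked as Linked using (Linked; [])
import Data.List.Relation.Unary.Linked.Properties as Linked
open import Data.List.Relation.Unary.Unique.Propositional using (Unique)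
import Data.List.Relation.Unary.Unique.Propositional.Properties as Unique
open import Data.Nat as ℕ using (zero; z≤n; s≤s; _≡ᵇ_; _≤ᵇ_; _!)
open import Data.Nat.Coprimality using (1-coprimeTo) renaming (sym to coprime-sym)
import Data.Nat.Properties as ℕ
open import Data.List.Sort ℕ.≤-decTotalOrder using (sort-↭; sort-↗)
open import Data.Product using (_,_; proj₁; proj₂)
open import Data.Rational as ℚ using (1ℚ; mkℚ; _+_; _*_; 1/_)
import Data.Rational.Properties as ℚ
open import Data.Rational.Solver using (module +-*-Solver)
open import Data.Sum using (_⊎_; inj₁; inj₂)
open import Function using (_∘_; id)
open import Function.Bundles using (Equivalence; mk⇔)
open import Relation.Binary.PropositionalEquality
  using (_≢_; refl; sym; trans; cong; cong₂; subst; subst₂; setoid; module ≡-Reasoning)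
open import Relation.Nullary using (Dec; ¬_; yes; no)

open +-*-Solver using (solve; _:=_; _:+_; _:*_; :-_)
open ≡-Reasoning

-- Embedding of ℕ in ℚ

-- The bounds `z i` are controlled only for i < n, so the counting recursion is available only for
-- sets of at most n elements. The interpolation formula, however, is checked on basis polynomials
-- of degree beyond n as well, because a polynomial is a coefficient list that may be padded with
-- zeros. The bridge is a rational sequence `G` defined by the recursion itself for every m: since
-- p_0 = 1, the term for the full subset has coefficient 1 and the recursion can be solved for it.
-- The numbers `ord` agree with `G` up to n, and `interpolation` sees only `G`. On the combinatorial
-- side, sorted lists are awkward to cut and glue, so order statistics are traded for counts: the
-- entry x_(i) is at most u exactly when more than i elements have final image at most u. Counts at
-- thresholds up to z_|A| ignore the elements outside A, and this lets the bounds pass between a map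
-- and its restriction to A.

ℕ→ℚ≡mkℚ : ∀ n → ℕ→ℚ n ≡ mkℚ (ℤ.+ n) 0 (coprime-sym (1-coprimeTo n))
ℕ→ℚ≡mkℚ n = ℚ.normalize-coprime (coprime-sym (1-coprimeTo n))

ℕ→ℚ-injective : ∀ {m n} → ℕ→ℚ m ≡ ℕ→ℚ n → m ≡ n
ℕ→ℚ-injective {m} {n} eq = ℤ.+-injective
  (cong ℚ.numerator (trans (sym (ℕ→ℚ≡mkℚ m)) (trans eq (ℕ→ℚ≡mkℚ n))))

ℕ→ℚ-≤ᵇ : ∀ m n → (ℕ→ℚ m ℚ.≤ᵇ ℕ→ℚ n) ≡ (m ℕ.≤ᵇ n)
ℕ→ℚ-≤ᵇ m n = begin
  ℕ→ℚ m ℚ.≤ᵇ ℕ→ℚ n                ≡⟨ cong₂ ℚ._≤ᵇ_ (ℕ→ℚ≡mkℚ m) (ℕ→ℚ≡mkℚ n) ⟩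
  (ℤ.+ m ℤ.* ℤ.+ 1) ℤ.≤ᵇ (ℤ.+ n ℤ.* ℤ.+ 1) ≡⟨ cong₂ ℤ._≤ᵇ_ (ℤ.*-identityʳ (ℤ.+ m)) (ℤ.*-identityʳ (ℤ.+ n)) ⟩
  m ℕ.≤ᵇ n                         ∎

ℕ→ℚ-homo-+ : ∀ m n → ℕ→ℚ (m ℕ.+ n) ≡ ℕ→ℚ m + ℕ→ℚ n
ℕ→ℚ-homo-+ m n = sym (begin
  ℕ→ℚ m + ℕ→ℚ n ≡⟨ cong₂ _+_ (ℕ→ℚ≡mkℚ m) (ℕ→ℚ≡mkℚ n) ⟩
  (ℤ.+ m ℤ.* ℤ.+ 1 ℤ.+ ℤ.+ n ℤ.* ℤ.+ 1) ℚ./ 1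
    ≡⟨ cong (ℚ._/ 1) (cong₂ ℤ._+_ (ℤ.*-identityʳ (ℤ.+ m)) (ℤ.*-identityʳ (ℤ.+ n))) ⟩
  ℕ→ℚ (m ℕ.+ n) ∎)

ℕ→ℚ-homo-* : ∀ m n → ℕ→ℚ (m ℕ.* n) ≡ ℕ→ℚ m * ℕ→ℚ n
ℕ→ℚ-homo-* m n = sym (begin
  ℕ→ℚ m * ℕ→ℚ n ≡⟨ cong₂ _*_ (ℕ→ℚ≡mkℚ m) (ℕ→ℚ≡mkℚ n) ⟩
  (ℤ.+ m ℤ.* ℤ.+ n) ℚ./ 1 ≡⟨ cong (ℚ._/ 1) (sym (ℤ.pos-* m n)) ⟩
  ℕ→ℚ (m ℕ.* n) ∎)

ℕ→ℚ-homo-∸ : ∀ {m n} → n ≤ m → ℕ→ℚ (m ℕ.∸ n) ≡ ℕ→ℚ m - ℕ→ℚ n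
ℕ→ℚ-homo-∸ {m} {n} n≤m = begin
  ℕ→ℚ (m ℕ.∸ n)                     ≡⟨ solve 2 (λ a b → a := (a :+ b) :+ (:- b)) refl _ (ℕ→ℚ n) ⟩
  ℕ→ℚ (m ℕ.∸ n) + ℕ→ℚ n - ℕ→ℚ n    ≡⟨ cong (_- ℕ→ℚ n) (ℕ→ℚ-homo-+ (m ℕ.∸ n) n) ⟨
  ℕ→ℚ (m ℕ.∸ n ℕ.+ n) - ℕ→ℚ n      ≡⟨ cong (λ k → ℕ→ℚ k - ℕ→ℚ n) (ℕ.m∸n+n≡m n≤m) ⟩
  ℕ→ℚ m - ℕ→ℚ n                     ∎

ℕ→ℚ-nonZero : ∀ n → ℚ.NonZero (ℕ→ℚ (suc n))
ℕ→ℚ-nonZero n = ℚ.≢-nonZero (λ eq → ℕ.1+n≢0 (ℕ→ℚ-injective {suc n} {0} eq))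

inv! : ℕ → ℚ
inv! zero = 1ℚ
inv! (suc n) = inv! n * 1/_ (ℕ→ℚ (suc n)) ⦃ ℕ→ℚ-nonZero n ⦄

suc*inv! : ∀ n → ℕ→ℚ (suc n) * inv! (suc n) ≡ inv! n
suc*inv! n = begin
  ℕ→ℚ (suc n) * (inv! n * 1/n) ≡⟨ solve 3 (λ a b c → a :* (b :* c) := b :* (a :* c)) refl (ℕ→ℚ (suc n)) (inv! n) 1/n ⟩
  inv! n * (ℕ→ℚ (suc n) * 1/n) ≡⟨ cong (inv! n *_) (ℚ.*-inverseʳ (ℕ→ℚ (suc n)) ⦃ ℕ→ℚ-nonZero n ⦄) ⟩
  inv! n * 1ℚ                  ≡⟨ ℚ.*-identityʳ (inv! n) ⟩
  inv! n                       ∎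
  where 1/n = 1/_ (ℕ→ℚ (suc n)) ⦃ ℕ→ℚ-nonZero n ⦄

inv!*! : ∀ n → inv! n * ℕ→ℚ (n !) ≡ 1ℚ
inv!*! zero = refl
inv!*! (suc n) = begin
  inv! (suc n) * ℕ→ℚ (suc n ℕ.* n !)          ≡⟨ cong (inv! (suc n) *_) (ℕ→ℚ-homo-* (suc n) (n !)) ⟩
  inv! (suc n) * (ℕ→ℚ (suc n) * ℕ→ℚ (n !))    ≡⟨ solve 3 (λ a b c → a :* (b :* c) := (b :* a) :* c) refl (inv! (suc n)) (ℕ→ℚ (suc n)) (ℕ→ℚ (n !)) ⟩
  ℕ→ℚ (suc n) * inv! (suc n) * ℕ→ℚ (n !)      ≡⟨ cong (_* ℕ→ℚ (n !)) (suc*inv! n) ⟩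
  inv! n * ℕ→ℚ (n !)                          ≡⟨ inv!*! n ⟩
  1ℚ                                          ∎

-- Polynomials as coefficient lists

coeff-+ₚ : ∀ p q k → coeff (p +ₚ q) k ≡ coeff p k + coeff q k
coeff-+ₚ [] q k = sym (ℚ.+-identityˡ _)
coeff-+ₚ (c ∷ p) [] k = sym (ℚ.+-identityʳ _)
coeff-+ₚ (c ∷ p) (d ∷ q) zero = refl
coeff-+ₚ (c ∷ p) (d ∷ q) (suc k) = coeff-+ₚ p q k

coeff-·ₚ : ∀ a p k → coeff (a ·ₚ p) k ≡ a * coeff p k
coeff-·ₚ a [] k = sym (ℚ.*-zeroʳ a)
coeff-·ₚ a (c ∷ p) zero = refl
coeff-·ₚ a (c ∷ p) (suc k) = coeff-·ₚ a p k

coeff-≥length : ∀ p k → length p ≤ k → coeff p k ≡ 0ℚ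
coeff-≥length [] k _ = refl
coeff-≥length (c ∷ p) (suc k) (s≤s le) = coeff-≥length p k le

≈ₚ-sym : ∀ {p q} → p ≈ₚ q → q ≈ₚ p
≈ₚ-sym eq k = sym (eq k)

+ₚ-cong : ∀ p p′ q q′ → p ≈ₚ p′ → q ≈ₚ q′ → p +ₚ q ≈ₚ p′ +ₚ q′
+ₚ-cong p p′ q q′ eq eq′ k =
  trans (coeff-+ₚ p q k) (trans (cong₂ _+_ (eq k) (eq′ k)) (sym (coeff-+ₚ p′ q′ k)))

·ₚ-cong : ∀ a p q → p ≈ₚ q → a ·ₚ p ≈ₚ a ·ₚ q
·ₚ-cong a p q eq k =
  trans (coeff-·ₚ a p k) (trans (cong (a *_) (eq k)) (sym (coeff-·ₚ a q k)))

linMul-cong : ∀ a p q → p ≈ₚ q → linMul a p ≈ₚ linMul a q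
linMul-cong a p q eq = +ₚ-cong (0ℚ ∷ p) (0ℚ ∷ q) (a ·ₚ p) (a ·ₚ q)
  (λ { zero → refl ; (suc k) → eq k }) (·ₚ-cong a p q eq)

-- Equal polynomials may be lists of different lengths, so each congruence proof meets the case
-- where one list has ended while the other continues with zeros only.
shift-≈0 : ∀ a p → p ≈ₚ [] → shift a p ≈ₚ []
shift-≈0 a [] eq k = refl
shift-≈0 a (c ∷ p) eq k = begin
  coeff ((c ∷ []) +ₚ linMul a (shift a p)) k ≡⟨ +ₚ-cong (c ∷ []) [] (linMul a (shift a p)) (linMul a [])
       (λ { zero → eq 0 ; (suc k) → refl }) (linMul-cong a (shift a p) [] (shift-≈0 a p (eq ∘ suc))) k ⟩
  coeff (0ℚ ∷ []) k ≡⟨ 0∷[]≈0 k ⟩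
  0ℚ ∎
  where
  0∷[]≈0 : 0ℚ ∷ [] ≈ₚ []
  0∷[]≈0 zero = refl
  0∷[]≈0 (suc k) = refl

shift-cong : ∀ a p q → p ≈ₚ q → shift a p ≈ₚ shift a q
shift-cong a [] q eq = ≈ₚ-sym {shift a q} {[]} (shift-≈0 a q (≈ₚ-sym {[]} {q} eq))
shift-cong a (c ∷ p) [] eq = shift-≈0 a (c ∷ p) eq
shift-cong a (c ∷ p) (d ∷ q) eq =
  +ₚ-cong (c ∷ []) (d ∷ []) (linMul a (shift a p)) (linMul a (shift a q))
    (λ { zero → eq 0 ; (suc k) → refl })
    (linMul-cong a (shift a p) (shift a q) (shift-cong a p q (eq ∘ suc)))

eval-≈0 : ∀ p r → p ≈ₚ [] → eval p r ≡ 0ℚ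
eval-≈0 [] r eq = refl
eval-≈0 (c ∷ p) r eq = trans (cong₂ (λ a b → a + r * b) (eq 0) (eval-≈0 p r (eq ∘ suc)))
  (trans (ℚ.+-identityˡ _) (ℚ.*-zeroʳ r))

eval-cong : ∀ p q r → p ≈ₚ q → eval p r ≡ eval q r
eval-cong [] q r eq = sym (eval-≈0 q r (≈ₚ-sym {[]} {q} eq))
eval-cong (c ∷ p) [] r eq = eval-≈0 (c ∷ p) r eq
eval-cong (c ∷ p) (d ∷ q) r eq = cong₂ (λ a b → a + r * b) (eq 0) (eval-cong p q r (eq ∘ suc))

eval-+ₚ : ∀ p q r → eval (p +ₚ q) r ≡ eval p r + eval q r
eval-+ₚ [] q r = sym (ℚ.+-identityˡ _)
eval-+ₚ (c ∷ p) [] r = sym (ℚ.+-identityʳ _)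
eval-+ₚ (c ∷ p) (d ∷ q) r = trans (cong (λ b → c + d + r * b) (eval-+ₚ p q r))
  (solve 5 (λ c d r u v → c :+ d :+ r :* (u :+ v) := c :+ r :* u :+ (d :+ r :* v)) refl
    c d r (eval p r) (eval q r))

eval-·ₚ : ∀ a p r → eval (a ·ₚ p) r ≡ a * eval p r
eval-·ₚ a [] r = sym (ℚ.*-zeroʳ a)
eval-·ₚ a (c ∷ p) r = trans (cong (λ b → a * c + r * b) (eval-·ₚ a p r))
  (solve 4 (λ a c r u → a :* c :+ r :* (a :* u) := a :* (c :+ r :* u)) refl a c r (eval p r))

eval-linMul : ∀ a q r → eval (linMul a q) r ≡ (r + a) * eval q r
eval-linMul a q r = begin
  eval ((0ℚ ∷ q) +ₚ (a ·ₚ q)) r       ≡⟨ eval-+ₚ (0ℚ ∷ q) (a ·ₚ q) r ⟩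
  0ℚ + r * eval q r + eval (a ·ₚ q) r ≡⟨ cong₂ _+_ (ℚ.+-identityˡ (r * eval q r)) (eval-·ₚ a q r) ⟩
  r * eval q r + a * eval q r         ≡⟨ ℚ.*-distribʳ-+ (eval q r) r a ⟨
  (r + a) * eval q r                  ∎

eval-shift : ∀ a p r → eval (shift a p) r ≡ eval p (r + a)
eval-shift a [] r = refl
eval-shift a (c ∷ p) r = begin
  eval ((c ∷ []) +ₚ linMul a (shift a p)) r            ≡⟨ eval-+ₚ (c ∷ []) (linMul a (shift a p)) r ⟩
  c + r * 0ℚ + eval (linMul a (shift a p)) r           ≡⟨ cong₂ _+_ (trans (cong (c +_) (ℚ.*-zeroʳ r)) (ℚ.+-identityʳ c))
                                                             (eval-linMul a (shift a p) r) ⟩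
  c + (r + a) * eval (shift a p) r                     ≡⟨ cong (λ b → c + (r + a) * b) (eval-shift a p r) ⟩
  c + (r + a) * eval p (r + a)                         ∎

-- Sums over subsets, graded by the sizes i of the subset and j of its complement

sumTo : ℕ → (ℕ → ℚ) → ℚ
sumTo zero f = 0ℚ
sumTo (suc n) f = f 0 + sumTo n (f ∘ suc)

antidiagonal : ℕ → (ℕ → ℕ → ℚ) → ℚ
antidiagonal zero a = a 0 0
antidiagonal (suc m) a = a 0 (suc m) + antidiagonal m (a ∘ suc)

-- Deciding element by element whether it belongs to the subset gives φ i (m - i) the weight "m
-- choose i" without naming a binomial coefficient, and follows the same recursion as `splits`.
subsetSum : ℕ → (ℕ → ℕ → ℚ) → ℚ
subsetSum zero φ = φ 0 0
subsetSum (suc m) φ = subsetSum m (φ ∘ suc) + subsetSum m (λ i → φ i ∘ suc)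

-- Omitting the full subset keeps the first argument of φ below m, so a value at m can be defined
-- from earlier ones. Once an element has gone to the complement, the rest is unrestricted.
properSubsetSum : ℕ → (ℕ → ℕ → ℚ) → ℚ
properSubsetSum zero φ = 0ℚ
properSubsetSum (suc m) φ = properSubsetSum m (φ ∘ suc) + subsetSum m (λ i → φ i ∘ suc)

subsetSum≡top+proper : ∀ m φ → subsetSum m φ ≡ φ m 0 + properSubsetSum m φ
subsetSum≡top+proper zero φ = sym (ℚ.+-identityʳ (φ 0 0))
subsetSum≡top+proper (suc m) φ = trans
  (cong (_+ subsetSum m (λ i → φ i ∘ suc)) (subsetSum≡top+proper m (φ ∘ suc)))
  (ℚ.+-assoc (φ (suc m) 0) _ _)

subsetSum-cong : ∀ m {φ ψ} → (∀ i j → i ≤ m → φ i j ≡ ψ i j) → subsetSum m φ ≡ subsetSum m ψ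
subsetSum-cong zero eq = eq 0 0 z≤n
subsetSum-cong (suc m) eq = cong₂ _+_
  (subsetSum-cong m (λ i j i≤m → eq (suc i) j (s≤s i≤m)))
  (subsetSum-cong m (λ i j i≤m → eq i (suc j) (ℕ.m≤n⇒m≤1+n i≤m)))

properSubsetSum-cong : ∀ m {φ ψ} → (∀ i j → i < m → φ i j ≡ ψ i j) →
  properSubsetSum m φ ≡ properSubsetSum m ψ
properSubsetSum-cong zero eq = refl
properSubsetSum-cong (suc m) eq = cong₂ _+_
  (properSubsetSum-cong m (λ i j i<m → eq (suc i) j (s≤s i<m)))
  (subsetSum-cong m (λ i j i≤m → eq i (suc j) (s≤s i≤m)))

antidiagonal-cong : ∀ m {a b} → (∀ i j → i ℕ.+ j ≡ m → a i j ≡ b i j) →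
  antidiagonal m a ≡ antidiagonal m b
antidiagonal-cong zero eq = eq 0 0 refl
antidiagonal-cong (suc m) eq = cong₂ _+_ (eq 0 (suc m) refl)
  (antidiagonal-cong m (λ i j i+j≡m → eq (suc i) j (cong suc i+j≡m)))

antidiagonal-+ : ∀ m a b →
  antidiagonal m (λ i j → a i j + b i j) ≡ antidiagonal m a + antidiagonal m b
antidiagonal-+ zero a b = refl
antidiagonal-+ (suc m) a b = trans (cong (a 0 (suc m) + b 0 (suc m) +_) (antidiagonal-+ m (a ∘ suc) (b ∘ suc)))
  (solve 4 (λ x y u v → x :+ y :+ (u :+ v) := x :+ u :+ (y :+ v)) refl
    (a 0 (suc m)) (b 0 (suc m)) (antidiagonal m (a ∘ suc)) (antidiagonal m (b ∘ suc)))

antidiagonal-* : ∀ m c a → antidiagonal m (λ i j → c * a i j) ≡ c * antidiagonal m a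
antidiagonal-* zero c a = refl
antidiagonal-* (suc m) c a = trans (cong (c * a 0 (suc m) +_) (antidiagonal-* m c (a ∘ suc)))
  (sym (ℚ.*-distribˡ-+ c (a 0 (suc m)) (antidiagonal m (a ∘ suc))))

antidiagonal-sucʳ : ∀ m a → (∀ i → a i 0 ≡ 0ℚ) →
  antidiagonal (suc m) a ≡ antidiagonal m (λ i → a i ∘ suc)
antidiagonal-sucʳ zero a eq = trans (cong (a 0 1 +_) (eq 1)) (ℚ.+-identityʳ (a 0 1))
antidiagonal-sucʳ (suc m) a eq = cong (a 0 (suc (suc m)) +_) (antidiagonal-sucʳ m (a ∘ suc) (eq ∘ suc))

antidiagonal-sucˡ : ∀ m a → (∀ j → a 0 j ≡ 0ℚ) →
  antidiagonal (suc m) a ≡ antidiagonal m (a ∘ suc)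
antidiagonal-sucˡ m a eq = trans (cong (_+ antidiagonal m (a ∘ suc)) (eq (suc m))) (ℚ.+-identityˡ _)

-- Pascal's rule in the form (i + j) / (i! j!) = 1 / ((i-1)! j!) + 1 / (i! (j-1)!).
subsetSum≡antidiagonal : ∀ m φ →
  subsetSum m φ ≡ ℕ→ℚ (m !) * antidiagonal m (λ i j → inv! i * inv! j * φ i j)
subsetSum≡antidiagonal zero φ = sym (trans (ℚ.*-identityˡ _) (ℚ.*-identityˡ (φ 0 0)))
subsetSum≡antidiagonal (suc m) φ = begin
  subsetSum m (φ ∘ suc) + subsetSum m (λ i → φ i ∘ suc)
    ≡⟨ cong₂ _+_ (subsetSum≡antidiagonal m (φ ∘ suc)) (subsetSum≡antidiagonal m (λ i → φ i ∘ suc)) ⟩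
  ℕ→ℚ (m !) * antidiagonal m (λ i j → inv! i * inv! j * φ (suc i) j)
    + ℕ→ℚ (m !) * antidiagonal m (λ i j → inv! i * inv! j * φ i (suc j))
    ≡⟨ ℚ.*-distribˡ-+ (ℕ→ℚ (m !)) _ _ ⟨
  ℕ→ℚ (m !) * (antidiagonal m (λ i j → inv! i * inv! j * φ (suc i) j)
    + antidiagonal m (λ i j → inv! i * inv! j * φ i (suc j)))
    ≡⟨ cong (ℕ→ℚ (m !) *_) (cong₂ _+_ left right) ⟩
  ℕ→ℚ (m !) * (antidiagonal (suc m) (λ i j → ℕ→ℚ i * term i j)
    + antidiagonal (suc m) (λ i j → ℕ→ℚ j * term i j))
    ≡⟨ cong (ℕ→ℚ (m !) *_) (antidiagonal-+ (suc m) (λ i j → ℕ→ℚ i * term i j) (λ i j → ℕ→ℚ j * term i j)) ⟨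
  ℕ→ℚ (m !) * antidiagonal (suc m) (λ i j → ℕ→ℚ i * term i j + ℕ→ℚ j * term i j)
    ≡⟨ cong (ℕ→ℚ (m !) *_) (antidiagonal-cong (suc m) sum) ⟩
  ℕ→ℚ (m !) * antidiagonal (suc m) (λ i j → ℕ→ℚ (suc m) * term i j)
    ≡⟨ cong (ℕ→ℚ (m !) *_) (antidiagonal-* (suc m) (ℕ→ℚ (suc m)) term) ⟩
  ℕ→ℚ (m !) * (ℕ→ℚ (suc m) * antidiagonal (suc m) term)
    ≡⟨ solve 3 (λ a b c → a :* (b :* c) := b :* a :* c) refl (ℕ→ℚ (m !)) (ℕ→ℚ (suc m)) (antidiagonal (suc m) term) ⟩
  ℕ→ℚ (suc m) * ℕ→ℚ (m !) * antidiagonal (suc m) term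
    ≡⟨ cong (_* antidiagonal (suc m) term) (ℕ→ℚ-homo-* (suc m) (m !)) ⟨
  ℕ→ℚ (suc m !) * antidiagonal (suc m) term ∎
  where
  term : ℕ → ℕ → ℚ
  term i j = inv! i * inv! j * φ i j

  left : antidiagonal m (λ i j → inv! i * inv! j * φ (suc i) j)
    ≡ antidiagonal (suc m) (λ i j → ℕ→ℚ i * term i j)
  left = sym (trans (antidiagonal-sucˡ m (λ i j → ℕ→ℚ i * term i j) (λ j → ℚ.*-zeroˡ (term 0 j)))
    (antidiagonal-cong m (λ i j _ → trans
      (solve 4 (λ n a b c → n :* (a :* b :* c) := n :* a :* b :* c) refl
        (ℕ→ℚ (suc i)) (inv! (suc i)) (inv! j) (φ (suc i) j))
      (cong (λ u → u * inv! j * φ (suc i) j) (suc*inv! i)))))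

  right : antidiagonal m (λ i j → inv! i * inv! j * φ i (suc j))
    ≡ antidiagonal (suc m) (λ i j → ℕ→ℚ j * term i j)
  right = sym (trans (antidiagonal-sucʳ m (λ i j → ℕ→ℚ j * term i j) (λ i → ℚ.*-zeroˡ (term i 0)))
    (antidiagonal-cong m (λ i j _ → trans
      (solve 4 (λ n a b c → n :* (a :* b :* c) := a :* (n :* b) :* c) refl
        (ℕ→ℚ (suc j)) (inv! i) (inv! (suc j)) (φ i (suc j)))
      (cong (λ u → inv! i * u * φ i (suc j)) (suc*inv! j)))))

  sum : ∀ i j → i ℕ.+ j ≡ suc m → ℕ→ℚ i * term i j + ℕ→ℚ j * term i j ≡ ℕ→ℚ (suc m) * term i j
  sum i j eq = trans (sym (ℚ.*-distribʳ-+ (term i j) (ℕ→ℚ i) (ℕ→ℚ j)))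
    (cong (_* term i j) (trans (sym (ℕ→ℚ-homo-+ i j)) (cong ℕ→ℚ eq)))

sumTo-cong : ∀ n {f g : ℕ → ℚ} → (∀ i → f i ≡ g i) → sumTo n f ≡ sumTo n g
sumTo-cong zero eq = refl
sumTo-cong (suc n) eq = cong₂ _+_ (eq 0) (sumTo-cong n (eq ∘ suc))

sumTo-+ : ∀ n f g → sumTo n (λ i → f i + g i) ≡ sumTo n f + sumTo n g
sumTo-+ zero f g = refl
sumTo-+ (suc n) f g = trans (cong (f 0 + g 0 +_) (sumTo-+ n (f ∘ suc) (g ∘ suc)))
  (solve 4 (λ x y u v → x :+ y :+ (u :+ v) := x :+ u :+ (y :+ v)) refl
    (f 0) (g 0) (sumTo n (f ∘ suc)) (sumTo n (g ∘ suc)))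

sumTo-* : ∀ n c f → sumTo n (λ i → c * f i) ≡ c * sumTo n f
sumTo-* zero c f = sym (ℚ.*-zeroʳ c)
sumTo-* (suc n) c f = trans (cong (c * f 0 +_) (sumTo-* n c (f ∘ suc))) (sym (ℚ.*-distribˡ-+ c (f 0) (sumTo n (f ∘ suc))))

sumTo-zero : ∀ n f → (∀ i → f i ≡ 0ℚ) → sumTo n f ≡ 0ℚ
sumTo-zero zero f eq = refl
sumTo-zero (suc n) f eq = trans (cong₂ _+_ (eq 0) (sumTo-zero n (f ∘ suc) (eq ∘ suc))) refl

sumTo-antidiagonal : ∀ {n m} f → m < n → (∀ i → m < i → f i ≡ 0ℚ) →
  sumTo n f ≡ antidiagonal m (λ i _ → f i)
sumTo-antidiagonal {suc n} {zero} f _ eq =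
  trans (cong (f 0 +_) (sumTo-zero n (f ∘ suc) (λ i → eq (suc i) (s≤s z≤n)))) (ℚ.+-identityʳ (f 0))
sumTo-antidiagonal {suc n} {suc m} f (s≤s m<n) eq =
  cong (f 0 +_) (sumTo-antidiagonal (f ∘ suc) m<n (λ i m<i → eq (suc i) (s≤s m<i)))

sumTo-single : ∀ {n m} f → m < n → (∀ i → i ≢ m → f i ≡ 0ℚ) → sumTo n f ≡ f m
sumTo-single {suc n} {zero} f _ eq =
  trans (cong (f 0 +_) (sumTo-zero n (f ∘ suc) (λ i → eq (suc i) (λ ())))) (ℚ.+-identityʳ (f 0))
sumTo-single {suc n} {suc m} f (s≤s m<n) eq =
  trans (cong₂ _+_ (eq 0 (λ ())) (sumTo-single (f ∘ suc) m<n (λ i i≢m → eq (suc i) (i≢m ∘ ℕ.suc-injective))))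
    (ℚ.+-identityˡ _)

-- Delta operators

module _ (𝔡 : DeltaOperator) where

  D-0 : D 𝔡 [] ≈ₚ []
  D-0 k = trans (D-· 𝔡 0ℚ [] k) (trans (coeff-·ₚ 0ℚ (D 𝔡 []) k) (ℚ.*-zeroˡ (coeff (D 𝔡 []) k)))

  -- Compare D (x + 1) = D x + D 1 with the shift of the constant D x.
  D-1 : D 𝔡 (1ℚ ∷ []) ≈ₚ []
  D-1 k = begin
    D₁                  ≡⟨ solve 2 (λ u v → v := (u :+ v) :+ (:- u)) refl Dₓ D₁ ⟩
    Dₓ + D₁ - Dₓ        ≡⟨ cong (_- Dₓ) (coeff-+ₚ (D 𝔡 xₚ) (D 𝔡 (1ℚ ∷ [])) k) ⟨
    coeff (D 𝔡 xₚ +ₚ D 𝔡 (1ℚ ∷ [])) k - Dₓ ≡⟨ cong (_- Dₓ) (D-+ 𝔡 xₚ (1ℚ ∷ []) k) ⟨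
    coeff (D 𝔡 (xₚ +ₚ (1ℚ ∷ []))) k - Dₓ   ≡⟨ cong (_- Dₓ) (D-cong 𝔡 (shift 1ℚ xₚ) (xₚ +ₚ (1ℚ ∷ [])) x+1 k) ⟨
    coeff (D 𝔡 (shift 1ℚ xₚ)) k - Dₓ       ≡⟨ cong (_- Dₓ) (D-shift 𝔡 1ℚ xₚ k) ⟩
    coeff (shift 1ℚ (D 𝔡 xₚ)) k - Dₓ       ≡⟨ cong (_- Dₓ) (shift-cong 1ℚ (D 𝔡 xₚ) (c ∷ []) Dx≈c k) ⟩
    coeff (shift 1ℚ (c ∷ [])) k - Dₓ       ≡⟨ cong₂ _-_ (const k) (Dx≈c k) ⟩
    coeff (c ∷ []) k - coeff (c ∷ []) k    ≡⟨ ℚ.+-inverseʳ (coeff (c ∷ []) k) ⟩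
    0ℚ                                     ∎
    where
    Dₓ = coeff (D 𝔡 xₚ) k
    D₁ = coeff (D 𝔡 (1ℚ ∷ [])) k
    c = proj₁ (D-x 𝔡)
    Dx≈c = proj₂ (proj₂ (D-x 𝔡))
    x+1 : shift 1ℚ xₚ ≈ₚ xₚ +ₚ (1ℚ ∷ [])
    x+1 0 = refl
    x+1 1 = refl
    x+1 (suc (suc _)) = refl
    const : shift 1ℚ (c ∷ []) ≈ₚ c ∷ []
    const zero = ℚ.+-identityʳ c
    const (suc _) = refl

  Dpow-cong : ∀ i p q → p ≈ₚ q → Dpow 𝔡 i p ≈ₚ Dpow 𝔡 i q
  Dpow-cong zero p q eq = eq
  Dpow-cong (suc i) p q eq = D-cong 𝔡 (Dpow 𝔡 i p) (Dpow 𝔡 i q) (Dpow-cong i p q eq)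

  Dpow-0 : ∀ i → Dpow 𝔡 i [] ≈ₚ []
  Dpow-0 zero k = refl
  Dpow-0 (suc i) k = trans (D-cong 𝔡 (Dpow 𝔡 i []) [] (Dpow-0 i) k) (D-0 k)

  Dpow-+ : ∀ i p q → Dpow 𝔡 i (p +ₚ q) ≈ₚ Dpow 𝔡 i p +ₚ Dpow 𝔡 i q
  Dpow-+ zero p q k = refl
  Dpow-+ (suc i) p q k = trans (D-cong 𝔡 (Dpow 𝔡 i (p +ₚ q)) (Dpow 𝔡 i p +ₚ Dpow 𝔡 i q) (Dpow-+ i p q) k)
    (D-+ 𝔡 (Dpow 𝔡 i p) (Dpow 𝔡 i q) k)

  Dpow-· : ∀ i a p → Dpow 𝔡 i (a ·ₚ p) ≈ₚ a ·ₚ Dpow 𝔡 i p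
  Dpow-· zero a p k = refl
  Dpow-· (suc i) a p k = trans (D-cong 𝔡 (Dpow 𝔡 i (a ·ₚ p)) (a ·ₚ Dpow 𝔡 i p) (Dpow-· i a p) k)
    (D-· 𝔡 a (Dpow 𝔡 i p) k)

  Dpow-shift : ∀ i a p → Dpow 𝔡 i (shift a p) ≈ₚ shift a (Dpow 𝔡 i p)
  Dpow-shift zero a p k = refl
  Dpow-shift (suc i) a p k = trans (D-cong 𝔡 (Dpow 𝔡 i (shift a p)) (shift a (Dpow 𝔡 i p)) (Dpow-shift i a p) k)
    (D-shift 𝔡 a (Dpow 𝔡 i p) k)

  Dpow-suc : ∀ i p → Dpow 𝔡 (suc i) p ≈ₚ Dpow 𝔡 i (D 𝔡 p)
  Dpow-suc zero p k = refl
  Dpow-suc (suc i) p k = D-cong 𝔡 (Dpow 𝔡 (suc i) p) (Dpow 𝔡 i (D 𝔡 p)) (Dpow-suc i p) k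

  eval-Dpow-shift : ∀ i a p r → eval (Dpow 𝔡 i (shift a p)) r ≡ eval (Dpow 𝔡 i p) (r + a)
  eval-Dpow-shift i a p r =
    trans (eval-cong (Dpow 𝔡 i (shift a p)) (shift a (Dpow 𝔡 i p)) r (Dpow-shift i a p))
      (eval-shift a (Dpow 𝔡 i p) r)

-- Polynomial sequences with one member in each degree

module _ {p : ℕ → Poly} (deg : ∀ n → HasDegree (p n) n) where

  -- Subtracting the multiple of `p n` that cancels the coefficient of degree n lowers the degree.
  -- Phrasing this as an induction principle for a linear property avoids representing linear
  -- combinations; `Q` must respect `_≈ₚ_` because the combination reproduces `q` only up to
  -- trailing zeros.
  span : (Q : Poly → Set) → (∀ q r → q ≈ₚ r → Q q → Q r) → Q [] →
    (∀ q r → Q q → Q r → Q (q +ₚ r)) → (∀ a q → Q q → Q (a ·ₚ q)) →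
    ∀ n → (∀ m → m < n → Q (p m)) → ∀ q → (∀ k → n ≤ k → coeff q k ≡ 0ℚ) → Q q
  span Q resp Q0 Q+ Q· zero Qp q q≈0 = resp [] q (λ k → sym (q≈0 k z≤n)) Q0
  span Q resp Q0 Q+ Q· (suc n) Qp q q≈0 =
    resp (q′ +ₚ (c ·ₚ p n)) q q′+cp≈q
      (Q+ q′ (c ·ₚ p n)
        (span Q resp Q0 Q+ Q· n (λ m m<n → Qp m (ℕ.m≤n⇒m≤1+n m<n)) q′ q′≈0)
        (Q· c (p n) (Qp n ℕ.≤-refl)))
    where
    instance
      lead≢0 : ℚ.NonZero (coeff (p n) n)
      lead≢0 = ℚ.≢-nonZero (proj₁ (deg n))
    c = coeff q n * 1/ coeff (p n) n
    q′ = q +ₚ ((- c) ·ₚ p n)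
    coeff-q′ : ∀ k → coeff q′ k ≡ coeff q k + (- c) * coeff (p n) k
    coeff-q′ k = trans (coeff-+ₚ q ((- c) ·ₚ p n) k) (cong (coeff q k +_) (coeff-·ₚ (- c) (p n) k))
    q′+cp≈q : q′ +ₚ (c ·ₚ p n) ≈ₚ q
    q′+cp≈q k = trans (coeff-+ₚ q′ (c ·ₚ p n) k)
      (trans (cong₂ _+_ (coeff-q′ k) (coeff-·ₚ c (p n) k))
        (solve 3 (λ u c v → u :+ (:- c) :* v :+ c :* v := u) refl (coeff q k) c (coeff (p n) k)))
    q′≈0 : ∀ k → n ≤ k → coeff q′ k ≡ 0ℚ
    q′≈0 k n≤k with ℕ.m≤n⇒m<n∨m≡n n≤k
    ... | inj₁ n<k = trans (coeff-q′ k) (trans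
      (cong₂ (λ u v → u + (- c) * v) (q≈0 k n<k) (proj₂ (deg n) k n<k))
      (trans (ℚ.+-identityˡ _) (ℚ.*-zeroʳ (- c))))
    ... | inj₂ refl = begin
      coeff q′ n                                          ≡⟨ coeff-q′ n ⟩
      coeff q n + (- c) * coeff (p n) n
        ≡⟨ solve 3 (λ u i l → u :+ (:- (u :* i)) :* l := u :+ (:- (u :* (i :* l)))) refl
             (coeff q n) (1/ coeff (p n) n) (coeff (p n) n) ⟩
      coeff q n - coeff q n * (1/ coeff (p n) n * coeff (p n) n)
        ≡⟨ cong (λ u → coeff q n - coeff q n * u) (ℚ.*-inverseˡ (coeff (p n) n)) ⟩
      coeff q n - coeff q n * 1ℚ                          ≡⟨ cong (λ u → coeff q n - u) (ℚ.*-identityʳ _) ⟩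
      coeff q n - coeff q n                               ≡⟨ ℚ.+-inverseʳ (coeff q n) ⟩
      0ℚ                                                  ∎

-- Basic sequences and the interpolation formula

module _ {𝔡 : DeltaOperator} {p : ℕ → Poly} (basic : IsBasicSequence 𝔡 p) where

  private
    -- Division by m! turns 𝔡 into a pure lowering of the index, so the falling factorials n!/(n-i)!
    -- disappear from the powers of 𝔡.
    P : ℕ → Poly
    P m = inv! m ·ₚ p m

  D-normalised : ∀ m → D 𝔡 (P (suc m)) ≈ₚ P m
  D-normalised m k = begin
    coeff (D 𝔡 (inv! (suc m) ·ₚ p (suc m))) k         ≡⟨ D-· 𝔡 (inv! (suc m)) (p (suc m)) k ⟩
    coeff (inv! (suc m) ·ₚ D 𝔡 (p (suc m))) k         ≡⟨ coeff-·ₚ (inv! (suc m)) (D 𝔡 (p (suc m))) k ⟩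
    inv! (suc m) * coeff (D 𝔡 (p (suc m))) k          ≡⟨ cong (inv! (suc m) *_) (proj₂ (proj₂ (proj₂ basic)) m k) ⟩
    inv! (suc m) * coeff (ℕ→ℚ (suc m) ·ₚ p m) k       ≡⟨ cong (inv! (suc m) *_) (coeff-·ₚ (ℕ→ℚ (suc m)) (p m) k) ⟩
    inv! (suc m) * (ℕ→ℚ (suc m) * coeff (p m) k)
      ≡⟨ solve 3 (λ a b c → a :* (b :* c) := b :* a :* c) refl (inv! (suc m)) (ℕ→ℚ (suc m)) (coeff (p m) k) ⟩
    ℕ→ℚ (suc m) * inv! (suc m) * coeff (p m) k        ≡⟨ cong (_* coeff (p m) k) (suc*inv! m) ⟩
    inv! m * coeff (p m) k                            ≡⟨ coeff-·ₚ (inv! m) (p m) k ⟨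
    coeff (P m) k                                     ∎

  Dpow-normalised : ∀ i j → Dpow 𝔡 i (P (i ℕ.+ j)) ≈ₚ P j
  Dpow-normalised zero j k = refl
  Dpow-normalised (suc i) j k = trans (Dpow-suc 𝔡 i (P (suc (i ℕ.+ j))) k)
    (trans (Dpow-cong 𝔡 i (D 𝔡 (P (suc (i ℕ.+ j)))) (P (i ℕ.+ j)) (D-normalised (i ℕ.+ j)) k)
      (Dpow-normalised i j k))

  -- After m steps only the constant `P 0` is left, and by `D-1` the next application of 𝔡
  -- annihilates it.
  Dpow-normalised-≈0 : ∀ i m → m < i → Dpow 𝔡 i (P m) ≈ₚ []
  Dpow-normalised-≈0 (suc i) zero _ k = trans (Dpow-suc 𝔡 i (P 0) k)
    (trans (Dpow-cong 𝔡 i (D 𝔡 (P 0)) [] DP₀≈0 k) (Dpow-0 𝔡 i k))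
    where
    DP₀≈0 : D 𝔡 (P 0) ≈ₚ []
    DP₀≈0 k = trans (D-cong 𝔡 (P 0) (1ℚ ∷ []) (λ k → trans (coeff-·ₚ 1ℚ (p 0) k)
      (trans (ℚ.*-identityˡ _) (proj₁ (proj₂ basic) k))) k) (D-1 𝔡 k)
  Dpow-normalised-≈0 (suc i) (suc m) (s≤s m<i) k = trans (Dpow-suc 𝔡 i (P (suc m)) k)
    (trans (Dpow-cong 𝔡 i (D 𝔡 (P (suc m))) (P m) (D-normalised m) k) (Dpow-normalised-≈0 i m m<i k))

  -- Every polynomial q of degree < N satisfies q(y) = Σ_{i<N} (𝔡ⁱ q)(wᵢ) Gᵢ / i!, since the
  -- hypothesis says so for the basis (pₘ).
  interpolation : (w : ℕ → ℚ) (y : ℚ) (G : ℕ → ℚ) →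
    (∀ m → eval (p m) y ≡ subsetSum m (λ i j → eval (p j) (w i) * G i)) →
    ∀ n t → (∀ i → eval (Dpow 𝔡 i t) (w i) ≡ (if i ≡ᵇ n then ℕ→ℚ (n !) else 0ℚ)) →
    eval t y ≡ G n
  interpolation w y G rec n t t-dual = begin
    eval t y            ≡⟨ span {p} deg (λ q → eval q y ≡ L q) L-resp L-0 L-plus L-scale N
                             (λ m m<N → L-p m m<N) t (λ k N≤k → coeff-≥length t k (ℕ.≤-trans (ℕ.m≤n+m (length t) (suc n)) N≤k)) ⟩
    L t                 ≡⟨ sumTo-single (L-term t) (ℕ.m≤m+n (suc n) (length t)) off-diagonal ⟩
    inv! n * eval (Dpow 𝔡 n t) (w n) * G n ≡⟨ cong (λ u → inv! n * u * G n) (trans (t-dual n) (if-true (ℕ.≡⇒≡ᵇ n n refl))) ⟩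
    inv! n * ℕ→ℚ (n !) * G n               ≡⟨ cong (_* G n) (inv!*! n) ⟩
    1ℚ * G n                               ≡⟨ ℚ.*-identityˡ (G n) ⟩
    G n                                    ∎
    where
    deg = proj₁ basic
    N = suc n ℕ.+ length t

    L-term : Poly → ℕ → ℚ
    L-term q i = inv! i * eval (Dpow 𝔡 i q) (w i) * G i

    L : Poly → ℚ
    L q = sumTo N (L-term q)

    if-true : ∀ {b} {u v : ℚ} → T b → (if b then u else v) ≡ u
    if-true {true} _ = refl

    if-false : ∀ {i} {u v : ℚ} → i ≢ n → (if i ≡ᵇ n then u else v) ≡ v
    if-false {i} i≢n with i ≡ᵇ n in eq
    ... | true = ⊥-elim (i≢n (ℕ.≡ᵇ⇒≡ i n (subst T (sym eq) _)))
    ... | false = refl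

    off-diagonal : ∀ i → i ≢ n → inv! i * eval (Dpow 𝔡 i t) (w i) * G i ≡ 0ℚ
    off-diagonal i i≢n = trans (cong (λ u → inv! i * u * G i) (trans (t-dual i) (if-false i≢n)))
      (trans (cong (_* G i) (ℚ.*-zeroʳ (inv! i))) (ℚ.*-zeroˡ (G i)))

    L-cong : ∀ q r → q ≈ₚ r → L q ≡ L r
    L-cong q r eq = sumTo-cong N (λ i → cong (λ u → inv! i * u * G i)
      (eval-cong (Dpow 𝔡 i q) (Dpow 𝔡 i r) (w i) (Dpow-cong 𝔡 i q r eq)))

    L-resp : ∀ q r → q ≈ₚ r → eval q y ≡ L q → eval r y ≡ L r
    L-resp q r eq Lq = trans (sym (eval-cong q r y eq)) (trans Lq (L-cong q r eq))

    L-0 : 0ℚ ≡ L []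
    L-0 = sym (sumTo-zero N _ (λ i → trans
      (cong (λ u → inv! i * u * G i) (eval-≈0 (Dpow 𝔡 i []) (w i) (Dpow-0 𝔡 i)))
      (trans (cong (_* G i) (ℚ.*-zeroʳ (inv! i))) (ℚ.*-zeroˡ (G i)))))

    L-plus : ∀ q r → eval q y ≡ L q → eval r y ≡ L r → eval (q +ₚ r) y ≡ L (q +ₚ r)
    L-plus q r Lq Lr = trans (eval-+ₚ q r y) (trans (cong₂ _+_ Lq Lr) (sym (trans
      (sumTo-cong N (λ i → trans
        (cong (λ u → inv! i * u * G i) (trans (eval-cong (Dpow 𝔡 i (q +ₚ r)) (Dpow 𝔡 i q +ₚ Dpow 𝔡 i r) (w i) (Dpow-+ 𝔡 i q r))
          (eval-+ₚ (Dpow 𝔡 i q) (Dpow 𝔡 i r) (w i))))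
        (solve 4 (λ a u v g → a :* (u :+ v) :* g := a :* u :* g :+ a :* v :* g) refl
          (inv! i) (eval (Dpow 𝔡 i q) (w i)) (eval (Dpow 𝔡 i r) (w i)) (G i))))
      (sumTo-+ N (L-term q) (L-term r)))))

    L-· : ∀ a q → L (a ·ₚ q) ≡ a * L q
    L-· a q = trans
      (sumTo-cong N (λ i → trans
        (cong (λ u → inv! i * u * G i) (trans (eval-cong (Dpow 𝔡 i (a ·ₚ q)) (a ·ₚ Dpow 𝔡 i q) (w i) (Dpow-· 𝔡 i a q))
          (eval-·ₚ a (Dpow 𝔡 i q) (w i))))
        (solve 4 (λ e a u g → e :* (a :* u) :* g := a :* (e :* u :* g)) refl
          (inv! i) a (eval (Dpow 𝔡 i q) (w i)) (G i))))
      (sumTo-* N a (L-term q))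

    L-scale : ∀ a q → eval q y ≡ L q → eval (a ·ₚ q) y ≡ L (a ·ₚ q)
    L-scale a q Lq = trans (eval-·ₚ a q y) (trans (cong (a *_) Lq) (sym (L-· a q)))

    -- 𝔡ⁱ sends `P m` to `P (m - i)`, or to 0 when i > m, so the sum collapses to i + j = m with
    -- weights 1/(i! j!). This is the subset sum divided by m!, which is why the recursion for p_m
    -- says exactly that the formula holds for p_m.
    L-P : ∀ m → m < N → L (P m) ≡ antidiagonal m (λ i j → inv! i * inv! j * (eval (p j) (w i) * G i))
    L-P m m<N = trans
      (sumTo-antidiagonal _ m<N (λ i m<i → trans
        (cong (λ u → inv! i * u * G i) (eval-≈0 (Dpow 𝔡 i (P m)) (w i) (Dpow-normalised-≈0 i m m<i)))
        (trans (cong (_* G i) (ℚ.*-zeroʳ (inv! i))) (ℚ.*-zeroˡ (G i)))))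
      (antidiagonal-cong m λ { i j refl → trans
        (cong (λ u → inv! i * u * G i) (trans (eval-cong (Dpow 𝔡 i (P (i ℕ.+ j))) (P j) (w i) (Dpow-normalised i j))
          (eval-·ₚ (inv! j) (p j) (w i))))
        (solve 4 (λ a b u g → a :* (b :* u) :* g := a :* b :* (u :* g)) refl (inv! i) (inv! j) (eval (p j) (w i)) (G i)) })

    L-p : ∀ m → m < N → eval (p m) y ≡ L (p m)
    L-p m m<N = begin
      eval (p m) y                                  ≡⟨ rec m ⟩
      subsetSum m (λ i j → eval (p j) (w i) * G i)  ≡⟨ subsetSum≡antidiagonal m _ ⟩
      ℕ→ℚ (m !) * antidiagonal m (λ i j → inv! i * inv! j * (eval (p j) (w i) * G i))
                                                    ≡⟨ cong (ℕ→ℚ (m !) *_) (L-P m m<N) ⟨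
      ℕ→ℚ (m !) * L (P m)                           ≡⟨ cong (ℕ→ℚ (m !) *_) (L-· (inv! m) (p m)) ⟩
      ℕ→ℚ (m !) * (inv! m * L (p m))
        ≡⟨ solve 3 (λ a b c → a :* (b :* c) := b :* a :* c) refl (ℕ→ℚ (m !)) (inv! m) (L (p m)) ⟩
      inv! m * ℕ→ℚ (m !) * L (p m)                  ≡⟨ cong (_* L (p m)) (inv!*! m) ⟩
      1ℚ * L (p m)                                  ≡⟨ ℚ.*-identityˡ (L (p m)) ⟩
      L (p m)                                       ∎

-- Solving a recursion over proper subsets

module _ (h : ℕ → ℚ) (k : ℕ → ℕ → ℚ) where

  private
    -- The fuel makes the recursion structural. The value at m calls only arguments below m, so any
    -- fuel above m gives the same result and the default 0 never contributes to `solution`.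
    approx : ℕ → ℕ → ℚ
    approx zero m = 0ℚ
    approx (suc fuel) m = h m - properSubsetSum m (λ i j → k i j * approx fuel i)

    approx-stable : ∀ {fuel fuel′} m → m < fuel → m < fuel′ → approx fuel m ≡ approx fuel′ m
    approx-stable {suc fuel} {suc fuel′} m (s≤s m≤f) (s≤s m≤f′) =
      cong (λ u → h m - u) (properSubsetSum-cong m (λ i j i<m → cong (k i j *_)
        (approx-stable i (ℕ.<-≤-trans i<m m≤f) (ℕ.<-≤-trans i<m m≤f′))))

  solution : ℕ → ℚ
  solution m = approx (suc m) m

  solution-rec : ∀ m → solution m ≡ h m - properSubsetSum m (λ i j → k i j * solution i)
  solution-rec m = cong (λ u → h m - u) (properSubsetSum-cong m (λ i j i<m →
    cong (k i j *_) (approx-stable i i<m ℕ.≤-refl)))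

-- Lists without repetition

T⇔⇒≡ : ∀ {b c} → (T b → T c) → (T c → T b) → b ≡ c
T⇔⇒≡ {false} {false} f g = refl
T⇔⇒≡ {false} {true}  f g = ⊥-elim (g _)
T⇔⇒≡ {true}  {false} f g = ⊥-elim (f _)
T⇔⇒≡ {true}  {true}  f g = refl

T-true : ∀ {b} → T b → b ≡ true
T-true = Equivalence.to T-≡

¬T-false : ∀ {b} → ¬ T b → b ≡ false
¬T-false {false} _ = refl
¬T-false {true} ¬t = ⊥-elim (¬t _)

module _ {A : Set} where

  filterᵇ≡filter : (P : A → Bool) → ∀ xs → filterᵇ P xs ≡ filter (T? ∘ P) xs
  filterᵇ≡filter P [] = refl
  filterᵇ≡filter P (x ∷ xs) with P x
  ... | true = cong (x ∷_) (filterᵇ≡filter P xs)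
  ... | false = filterᵇ≡filter P xs

  ∈-filterᵇ⁺ : (P : A → Bool) → ∀ {x xs} → x ∈ xs → T (P x) → x ∈ filterᵇ P xs
  ∈-filterᵇ⁺ P {x} {xs} x∈xs Px = subst (x ∈_) (sym (filterᵇ≡filter P xs)) (∈-filter⁺ (T? ∘ P) x∈xs Px)

  ∈-filterᵇ⁻ : (P : A → Bool) → ∀ {x xs} → x ∈ filterᵇ P xs → x ∈ xs × T (P x)
  ∈-filterᵇ⁻ P {x} {xs} x∈ = ∈-filter⁻ (T? ∘ P) (subst (x ∈_) (filterᵇ≡filter P xs) x∈)

  filterᵇ-unique : (P : A → Bool) → ∀ {xs} → Unique xs → Unique (filterᵇ P xs)
  filterᵇ-unique P {xs} u = subst Unique (sym (filterᵇ≡filter P xs)) (Unique.filter⁺ (T? ∘ P) u)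

  length-filterᵇ : (P : A → Bool) → ∀ xs → length (filterᵇ P xs) ≤ length xs
  length-filterᵇ P xs = subst (λ ys → length ys ≤ length xs) (sym (filterᵇ≡filter P xs)) (length-filter (T? ∘ P) xs)

  filterᵇ-all : (P : A → Bool) → ∀ xs → (∀ x → x ∈ xs → T (P x)) → filterᵇ P xs ≡ xs
  filterᵇ-all P xs Ps = trans (filterᵇ≡filter P xs) (filter-all (T? ∘ P) (All.tabulate (Ps _)))

  filterᵇ-none : (P : A → Bool) → ∀ xs → (∀ x → x ∈ xs → ¬ T (P x)) → filterᵇ P xs ≡ []
  filterᵇ-none P xs ¬Ps = trans (filterᵇ≡filter P xs) (filter-none (T? ∘ P) (All.tabulate (¬Ps _)))

  filterᵇ-cong : (P Q : A → Bool) → ∀ xs → (∀ x → x ∈ xs → P x ≡ Q x) → filterᵇ P xs ≡ filterᵇ Q xs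
  filterᵇ-cong P Q [] eq = refl
  filterᵇ-cong P Q (x ∷ xs) eq rewrite eq x (here refl) with Q x
  ... | true = cong (x ∷_) (filterᵇ-cong P Q xs (λ y → eq y ∘ there))
  ... | false = filterᵇ-cong P Q xs (λ y → eq y ∘ there)

  filterᵇ-filterᵇ : (P Q : A → Bool) → ∀ xs → (∀ x → x ∈ xs → T (P x) → T (Q x)) →
    filterᵇ P (filterᵇ Q xs) ≡ filterᵇ P xs
  filterᵇ-filterᵇ P Q [] imp = refl
  filterᵇ-filterᵇ P Q (x ∷ xs) imp with P x in Px | Q x in Qx
  ... | true | true rewrite Px = cong (x ∷_) (filterᵇ-filterᵇ P Q xs (λ y → imp y ∘ there))
  ... | true | false = ⊥-elim (subst T Qx (imp x (here refl) (subst T (sym Px) _)))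
  ... | false | true rewrite Px = filterᵇ-filterᵇ P Q xs (λ y → imp y ∘ there)
  ... | false | false = filterᵇ-filterᵇ P Q xs (λ y → imp y ∘ there)

  length-filterᵇ-mono : (P Q : A → Bool) → ∀ xs → (∀ x → x ∈ xs → T (P x) → T (Q x)) →
    length (filterᵇ P xs) ≤ length (filterᵇ Q xs)
  length-filterᵇ-mono P Q xs imp = subst (λ ys → length ys ≤ length (filterᵇ Q xs))
    (filterᵇ-filterᵇ P Q xs imp) (length-filterᵇ P (filterᵇ Q xs))

  length-filterᵇ-maximal : (P : A → Bool) → ∀ xs → length xs ≤ length (filterᵇ P xs) → ∀ x → x ∈ xs → T (P x)
  length-filterᵇ-maximal P (x ∷ xs) le y y∈ with P x in Px
  length-filterᵇ-maximal P (x ∷ xs) le y (here refl) | true = subst T (sym Px) _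
  length-filterᵇ-maximal P (x ∷ xs) (s≤s le) y (there y∈) | true = length-filterᵇ-maximal P xs le y y∈
  ... | false = ⊥-elim (ℕ.<⇒≱ (ℕ.≤-<-trans (length-filterᵇ P xs) ℕ.≤-refl) le)

  length-filterᵇ-↭ : (P : A → Bool) → ∀ {xs ys} → xs ↭ ys → length (filterᵇ P xs) ≡ length (filterᵇ P ys)
  length-filterᵇ-↭ P {xs} {ys} xs↭ys = trans (cong length (filterᵇ≡filter P xs))
    (trans (↭-length (filter-↭ (T? ∘ P) xs↭ys)) (cong length (sym (filterᵇ≡filter P ys))))

  length-filterᵇ-map : ∀ {B : Set} (φ : B → A) (P : A → Bool) xs →
    length (filterᵇ P (map φ xs)) ≡ length (filterᵇ (P ∘ φ) xs)
  length-filterᵇ-map φ P [] = refl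
  length-filterᵇ-map φ P (x ∷ xs) with P (φ x)
  ... | true = cong suc (length-filterᵇ-map φ P xs)
  ... | false = length-filterᵇ-map φ P xs

  -- All counts in the proof are lengths of lists without repetition, so two of them are compared by
  -- showing that the lists have the same members; the permutation between them is obtained from
  -- that.
  unique-same-length : ∀ {xs ys : List A} → Unique xs → Unique ys →
    (∀ x → x ∈ xs → x ∈ ys) → (∀ x → x ∈ ys → x ∈ xs) → length xs ≡ length ys
  unique-same-length u v to from =
    ↭-length (∼bag⇒↭ (unique∧set⇒bag u v (mk⇔ (to _) (from _))))

  unique-head : ∀ {x} {xs : List A} → Unique (x ∷ xs) → x ∉ xs
  unique-head (x≢xs ∷ _) = All¬⇒¬Any x≢xs

module _ {A B : Set} where

  unique-map : (f : A → B) → ∀ {xs} → (∀ x y → x ∈ xs → y ∈ xs → f x ≡ f y → x ≡ y) →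
    Unique xs → Unique (map f xs)
  unique-map f inj [] = []
  unique-map f {x ∷ xs} inj (x∉xs ∷ u) =
    All.tabulate (λ {b} b∈ eq → let (y , y∈xs , b≡fy) = ∈-map⁻ f b∈ in
      All.lookup x∉xs y∈xs (inj x y (here refl) (there y∈xs) (trans eq b≡fy)))
    ∷ unique-map f (λ y z y∈ z∈ → inj y z (there y∈) (there z∈)) u

  ∈-concatMap-intro : (k : A → List B) → ∀ {x xs b} → x ∈ xs → b ∈ k x → b ∈ concatMap k xs
  ∈-concatMap-intro k {x} {xs} {b} x∈xs b∈kx = ∈-concatMap⁺ k (Any.map (λ eq → subst (λ z → b ∈ k z) eq b∈kx) x∈xs)

  ∈-concatMap-elim : (k : A → List B) → ∀ xs {b} → b ∈ concatMap k xs → ∃[ x ] (x ∈ xs × b ∈ k x)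
  ∈-concatMap-elim k (x ∷ xs) b∈ with ∈-++⁻ (k x) b∈
  ... | inj₁ b∈kx = x , here refl , b∈kx
  ... | inj₂ b∈′ = let (y , y∈xs , b∈ky) = ∈-concatMap-elim k xs b∈′ in y , there y∈xs , b∈ky

  unique-concatMap : (k : A → List B) → ∀ {xs} → (∀ x → x ∈ xs → Unique (k x)) →
    (∀ x y b → x ∈ xs → y ∈ xs → b ∈ k x → b ∈ k y → x ≡ y) →
    Unique xs → Unique (concatMap k xs)
  unique-concatMap k uk disj [] = []
  unique-concatMap k {x ∷ xs} uk disj (x∉xs ∷ u) = Unique.++⁺ (uk x (here refl))
    (unique-concatMap k (λ y → uk y ∘ there) (λ y z b y∈ z∈ → disj y z b (there y∈) (there z∈)) u)
    (λ { {b} (b∈kx , b∈) → let (y , y∈xs , b∈ky) = ∈-concatMap-elim k xs b∈ in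
      All.lookup x∉xs y∈xs (disj x y b (here refl) (there y∈xs) b∈kx b∈ky) })

  length-concatMap-const : (k : A → List B) (n : ℕ) → (∀ x → length (k x) ≡ n) →
    ∀ xs → length (concatMap k xs) ≡ length xs ℕ.* n
  length-concatMap-const k n len [] = refl
  length-concatMap-const k n len (x ∷ xs) = trans (length-++ (k x))
    (cong₂ ℕ._+_ (len x) (length-concatMap-const k n len xs))

∈ᵇ⇒∈ : ∀ {e} X → T (e ∈ᵇ X) → e ∈ X
∈ᵇ⇒∈ {e} X t = Any.map (λ {y} → ℕ.≡ᵇ⇒≡ e y) (any⁻ (e ≡ᵇ_) X t)

∈⇒∈ᵇ : ∀ {e X} → e ∈ X → T (e ∈ᵇ X)
∈⇒∈ᵇ {e} e∈X = any⁺ (e ≡ᵇ_) (Any.map (λ {y} → ℕ.≡⇒≡ᵇ e y) e∈X)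

≡ᵇ-refl : ∀ e → (e ≡ᵇ e) ≡ true
≡ᵇ-refl e = T-true (ℕ.≡⇒≡ᵇ e e refl)

≢⇒≡ᵇ-false : ∀ {a b} → a ≢ b → (a ≡ᵇ b) ≡ false
≢⇒≡ᵇ-false {a} {b} a≢b = ¬T-false (a≢b ∘ ℕ.≡ᵇ⇒≡ a b)

finSet-unique : ∀ {S} → IsFinSet S → Unique S
finSet-unique = AllPairs.map ℕ.<⇒≢ ∘ Linked.Linked⇒AllPairs ℕ.<-trans

finSet-filterᵇ : ∀ P {S} → IsFinSet S → IsFinSet (filterᵇ P S)
finSet-filterᵇ P {S} fin = subst IsFinSet (sym (filterᵇ≡filter P S)) (Linked.filter⁺ (T? ∘ P) ℕ.<-trans fin)

-- Candidate maps and splittings of a finite set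

∈-cands⁺ : ∀ n {V f} → length f ≡ n → All (_∈ V) f → f ∈ cands n V
∈-cands⁺ zero {f = []} refl [] = here refl
∈-cands⁺ (suc n) {V} {v ∷ f} eq (v∈V ∷ f⊆V) =
  ∈-concatMap-intro (λ v → map (v ∷_) (cands n V)) v∈V (∈-map⁺ (v ∷_) (∈-cands⁺ n (ℕ.suc-injective eq) f⊆V))

unique-cands : ∀ n {V} → Unique V → Unique (cands n V)
unique-cands zero u = [] ∷ []
unique-cands (suc n) {V} u = unique-concatMap (λ v → map (v ∷_) (cands n V))
  (λ v _ → unique-map (v ∷_) (λ x y _ _ → proj₂ ∘ ∷-injective) (unique-cands n u))
  (λ v w b _ _ b∈ b∈′ → let (_ , _ , eq) = ∈-map⁻ (v ∷_) b∈ ; (_ , _ , eq′) = ∈-map⁻ (w ∷_) b∈′ in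
    proj₁ (∷-injective (trans (sym eq) eq′)))
  u

-- Each subset is listed together with its complement, both in the order of S, so that they coincide
-- with filters of S and can serve directly as domains for the binomial class.
splits : List ℕ → List (List ℕ × List ℕ)
splits [] = ([] , []) ∷ []
splits (s ∷ S) = map (λ (A , C) → s ∷ A , C) (splits S) ++ map (λ (A , C) → A , s ∷ C) (splits S)

splits-⊆ : ∀ S {A C} → (A , C) ∈ splits S → ∀ {e} → e ∈ A → e ∈ S
splits-⊆ [] (here refl) ()
splits-⊆ (s ∷ S) AC∈ e∈A with ∈-++⁻ (map (λ (A , C) → s ∷ A , C) (splits S)) AC∈
... | inj₁ AC∈ˡ with ∈-map⁻ _ AC∈ˡ
splits-⊆ (s ∷ S) AC∈ (here eq) | inj₁ AC∈ˡ | _ , _ , refl = here eq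
splits-⊆ (s ∷ S) AC∈ (there e∈A) | inj₁ AC∈ˡ | _ , A′C∈ , refl = there (splits-⊆ S A′C∈ e∈A)
splits-⊆ (s ∷ S) AC∈ e∈A | inj₂ AC∈ʳ with ∈-map⁻ _ AC∈ʳ
... | _ , AC′∈ , refl = there (splits-⊆ S AC′∈ e∈A)

-- The axioms of a binomial class describe the two parts by a Boolean mask on S. For a pair from
-- `splits` the mask is membership in A; since S has no repetitions, the head put into one part is
-- not met again in the tail.
splits-mask : ∀ {S} → Unique S → ∀ {A C} → (A , C) ∈ splits S →
  filterᵇ (_∈ᵇ A) S ≡ A × filterᵇ (λ e → not (e ∈ᵇ A)) S ≡ C
splits-mask {[]} u (here refl) = refl , refl
splits-mask {s ∷ S} u@(_ ∷ u′) AC∈ with ∈-++⁻ (map (λ (A , C) → s ∷ A , C) (splits S)) AC∈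
... | inj₁ AC∈ˡ with ∈-map⁻ _ AC∈ˡ
...   | (A , C) , A′C∈ , refl rewrite ≡ᵇ-refl s =
  cong (s ∷_) (trans (filterᵇ-cong (_∈ᵇ (s ∷ A)) (_∈ᵇ A) S agree) (proj₁ ih)) ,
  trans (filterᵇ-cong (λ e → not (e ∈ᵇ (s ∷ A))) (λ e → not (e ∈ᵇ A)) S (λ e → cong not ∘ agree e)) (proj₂ ih)
  where
  ih = splits-mask u′ A′C∈
  agree : ∀ e → e ∈ S → (e ∈ᵇ (s ∷ A)) ≡ (e ∈ᵇ A)
  agree e e∈S rewrite ≢⇒≡ᵇ-false {e} {s} (λ { refl → unique-head u e∈S }) = refl
splits-mask {s ∷ S} u@(_ ∷ u′) AC∈ | inj₂ AC∈ʳ with ∈-map⁻ _ AC∈ʳ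
...   | (A , C) , AC′∈ , refl rewrite ¬T-false (unique-head u ∘ splits-⊆ S AC′∈ ∘ ∈ᵇ⇒∈ {s} A) =
  proj₁ ih , cong (s ∷_) (proj₂ ih)
  where ih = splits-mask u′ AC′∈

splits-complete : ∀ m S → (filterᵇ m S , filterᵇ (λ s → not (m s)) S) ∈ splits S
splits-complete m [] = here refl
splits-complete m (s ∷ S) with m s
... | true = ∈-++⁺ˡ (∈-map⁺ (λ (A , C) → s ∷ A , C) (splits-complete m S))
... | false = ∈-++⁺ʳ _ (∈-map⁺ (λ (A , C) → A , s ∷ C) (splits-complete m S))

unique-splits : ∀ {S} → Unique S → Unique (splits S)
unique-splits [] = [] ∷ []
unique-splits {s ∷ S} u@(_ ∷ u′) = Unique.++⁺
  (unique-map _ (λ { x y _ _ refl → refl }) (unique-splits u′))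
  (unique-map _ (λ { x y _ _ refl → refl }) (unique-splits u′))
  λ (b∈ , b∈′) → disjoint (∈-map⁻ _ b∈) (∈-map⁻ _ b∈′)
  where
  disjoint : ∀ {b} → ∃[ x ] (x ∈ splits S × b ≡ (s ∷ proj₁ x , proj₂ x)) →
    ∃[ x ] (x ∈ splits S × b ≡ (proj₁ x , s ∷ proj₂ x)) → ⊥
  disjoint (_ , _ , refl) (_ , x∈ , refl) = unique-head u (splits-⊆ S x∈ (here refl))

-- Reluctant functions

app-∉ : ∀ S f {e} → e ∉ S → app S f e ≡ e
app-∉ [] f e∉ = refl
app-∉ (s ∷ S) [] e∉ = refl
app-∉ (s ∷ S) (v ∷ f) {e} e∉ rewrite ≢⇒≡ᵇ-false {e} {s} (e∉ ∘ here) = app-∉ S f (e∉ ∘ there)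

app-map : ∀ φ S {e} → e ∈ S → app S (map φ S) e ≡ φ e
app-map φ (s ∷ S) {e} e∈ with e ≡ᵇ s in eq
... | true = cong φ (sym (ℕ.≡ᵇ⇒≡ e s (subst T (sym eq) _)))
app-map φ (s ∷ S) {e} (here refl) | false with () ← trans (sym eq) (≡ᵇ-refl s)
app-map φ (s ∷ S) {e} (there e∈) | false = app-map φ S e∈

map-app : ∀ S f → Unique S → length f ≡ length S → map (app S f) S ≡ f
map-app [] [] u eq = refl
map-app (s ∷ S) (v ∷ f) u@(_ ∷ u′) eq = cong₂ _∷_ head tail
  where
  head : app (s ∷ S) (v ∷ f) s ≡ v
  head rewrite ≡ᵇ-refl s = refl
  step : ∀ {e} → e ∈ S → app (s ∷ S) (v ∷ f) e ≡ app S f e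
  step {e} e∈S rewrite ≢⇒≡ᵇ-false {e} {s} (λ { refl → unique-head u e∈S }) = refl
  tail : map (app (s ∷ S) (v ∷ f)) S ≡ f
  tail = trans (map-cong-local (All.tabulate step)) (map-app S f u′ (ℕ.suc-injective eq))

app-All : ∀ {P : ℕ → Set} S f {e} → length f ≡ length S → All P f → e ∈ S → P (app S f e)
app-All (s ∷ S) (v ∷ f) {e} eq (Pv ∷ Pf) e∈ with e ≡ᵇ s in eq′
... | true = Pv
app-All (s ∷ S) (v ∷ f) {e} eq (Pv ∷ Pf) (here refl) | false with () ← trans (sym eq′) (≡ᵇ-refl s)
app-All (s ∷ S) (v ∷ f) {e} eq (Pv ∷ Pf) (there e∈) | false = app-All S f (ℕ.suc-injective eq) Pf e∈

iter-+ : ∀ j k g e → iter (j ℕ.+ k) g e ≡ iter j g (iter k g e)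
iter-+ zero k g e = refl
iter-+ (suc j) k g e = cong g (iter-+ j k g e)

iter-fixed : ∀ k g {e} → g e ≡ e → iter k g e ≡ e
iter-fixed zero g eq = refl
iter-fixed (suc k) g eq = trans (cong g (iter-fixed k g eq)) eq

-- Agreement is required only on a set `Q` that the orbit cannot leave. With both maps equal this is
-- the invariance of `Q` under iteration, and it is used in that form too.
iter-agree : (Q : ℕ → Set) (g f : ℕ → ℕ) → (∀ e → Q e → g e ≡ f e × Q (g e)) →
  ∀ k e → Q e → iter k g e ≡ iter k f e × Q (iter k g e)
iter-agree Q g f step zero e Qe = refl , Qe
iter-agree Q g f step (suc k) e Qe =
  let (eq , Qk) = iter-agree Q g f step k e Qe ; (eq′ , Qsk) = step _ Qk in
  trans eq′ (cong f eq) , Qsk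

module Reluctant {S X f : List ℕ} (S∩X : Disjoint S X) (rel : IsReluctant S X f) where

  private
    g = app S f

  closed : ∀ {e} → e ∈ S ⊎ e ∈ X → g e ∈ S ⊎ g e ∈ X
  closed (inj₁ e∈S) = app-All S f (proj₁ rel) (proj₁ (proj₂ rel)) e∈S
  closed {e} (inj₂ e∈X) = inj₂ (subst (_∈ X) (sym (app-∉ S f (λ e∈S → S∩X e e∈S e∈X))) e∈X)

  iter-closed : ∀ k {e} → e ∈ S → iter k g e ∈ S ⊎ iter k g e ∈ X
  iter-closed k e∈S = proj₂ (iter-agree (λ e → e ∈ S ⊎ e ∈ X) g g (λ e e∈ → refl , closed e∈) k _ (inj₁ e∈S))

  -- Points of X lie outside S, where `app` is the identity, so an orbit stays at the first point of
  -- X that it reaches.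
  absorbed : ∀ {j k s} → j ≤ k → iter j g s ∈ X → iter k g s ≡ iter j g s
  absorbed {j} {k} {s} j≤k ∈X = trans (cong (λ i → iter i g s) (sym (ℕ.m∸n+n≡m j≤k)))
    (trans (iter-+ (k ℕ.∸ j) j g s)
      (iter-fixed (k ℕ.∸ j) g (app-∉ S f (λ ∈S → S∩X _ ∈S ∈X))))

  iter-unique : ∀ j k {s} → iter j g s ∈ X → iter k g s ∈ X → iter j g s ≡ iter k g s
  iter-unique j k j∈ k∈ with ℕ.≤-total j k
  ... | inj₁ j≤k = sym (absorbed j≤k j∈)
  ... | inj₂ k≤j = absorbed k≤j k∈

  periodic : ∀ a d {s} → iter (d ℕ.+ a) g s ≡ iter a g s → ∀ r → iter (r ℕ.* d ℕ.+ a) g s ≡ iter a g s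
  periodic a d eq zero = refl
  periodic a d {s} eq (suc r) = begin
    iter (d ℕ.+ r ℕ.* d ℕ.+ a) g s        ≡⟨ cong (λ k → iter k g s) (ℕ.+-assoc d (r ℕ.* d) a) ⟩
    iter (d ℕ.+ (r ℕ.* d ℕ.+ a)) g s      ≡⟨ iter-+ d (r ℕ.* d ℕ.+ a) g s ⟩
    iter d g (iter (r ℕ.* d ℕ.+ a) g s)   ≡⟨ cong (iter d g) (periodic a d eq r) ⟩
    iter d g (iter a g s)                 ≡⟨ iter-+ d a g s ⟨
    iter (d ℕ.+ a) g s                    ≡⟨ eq ⟩
    iter a g s                            ∎

  -- If the first |S| + 1 points of the orbit all lay in S, two of them would coincide and
  -- the orbit would be periodic.
  finalImage∈ : ∀ {s} → s ∈ S → finalImage S f s ∈ X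
  finalImage∈ {s} s∈S with iter-closed (length S) s∈S
  ... | inj₂ ∈X = ∈X
  ... | inj₁ ∈S = ⊥-elim (S∩X _ (in-S a≤n) (subst (_∈ X) (trans (absorbed-late) (periodic a d period k)) k∈X))
    where
    n = length S
    k = proj₁ (proj₂ (proj₂ rel) s s∈S)
    k∈X = proj₂ (proj₂ (proj₂ (proj₂ rel) s s∈S))

    in-S : ∀ {i} → i ≤ n → iter i g s ∈ S
    in-S {i} i≤n with iter-closed i s∈S
    ... | inj₁ i∈S = i∈S
    ... | inj₂ i∈X = ⊥-elim (S∩X _ ∈S (subst (_∈ X) (sym (absorbed i≤n i∈X)) i∈X))

    position : Fin (suc n) → Fin n
    position i = index (in-S (ℕ.≤-pred (Fin.toℕ<n i)))

    collision = Fin.pigeonhole (ℕ.n<1+n n) position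
    i = proj₁ collision
    j = proj₁ (proj₂ collision)
    a = toℕ i
    d = toℕ j ℕ.∸ a
    a<b : a < toℕ j
    a<b = proj₁ (proj₂ (proj₂ collision))
    a≤n : a ≤ n
    a≤n = ℕ.≤-pred (Fin.toℕ<n i)

    period : iter (d ℕ.+ a) g s ≡ iter a g s
    period = trans (cong (λ k → iter k g s) (ℕ.m∸n+n≡m (ℕ.<⇒≤ a<b)))
      (sym (index-injective (setoid ℕ) (in-S a≤n) (in-S (ℕ.≤-pred (Fin.toℕ<n j)))
        (proj₂ (proj₂ (proj₂ collision)))))

    -- Reluctance gives no bound on k. But d is at least 1, so k periods after step a the index has
    -- passed k and the orbit rests in X; by periodicity it is then also at its a-th point, which
    -- lies in S.
    absorbed-late : iter k g s ≡ iter (k ℕ.* d ℕ.+ a) g s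
    absorbed-late = sym (absorbed (ℕ.≤-trans
      (ℕ.≤-trans (ℕ.≤-reflexive (sym (ℕ.*-identityʳ k))) (ℕ.*-monoʳ-≤ k (ℕ.m<n⇒0<n∸m a<b)))
      (ℕ.m≤m+n (k ℕ.* d) a)) k∈X)

-- The two final images are iterates with different exponents, |S| and |A|. On A ∪ X the two maps
-- agree and do not leave that set, so their |A|-th iterates coincide. Both iterates of `app S f`
-- then lie in Z, and an orbit meets Z in a single point.
finalImage-restrict : ∀ {S Z f A X g} → Disjoint S Z → IsReluctant S Z f →
  Disjoint A X → IsReluctant A X g → (∀ {e} → e ∈ A → e ∈ S) → (∀ {e} → e ∈ X → e ∈ Z) →
  (∀ {e} → e ∈ A → app S f e ≡ app A g e) →
  ∀ {s} → s ∈ A → finalImage S f s ≡ finalImage A g s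
finalImage-restrict {S} {Z} {f} {A} {X} {g} S∩Z rel-f A∩X rel-g A⊆S X⊆Z agree {s} s∈A = begin
  iter (length S) (app S f) s ≡⟨ F.iter-unique (length S) (length A) (F.finalImage∈ (A⊆S s∈A)) ∈Z ⟩
  iter (length A) (app S f) s ≡⟨ eq ⟨
  finalImage A g s            ∎
  where
  module F = Reluctant S∩Z rel-f
  module G = Reluctant A∩X rel-g
  step : ∀ e → e ∈ A ⊎ e ∈ X → app A g e ≡ app S f e × (app A g e ∈ A ⊎ app A g e ∈ X)
  step e (inj₁ e∈A) = sym (agree e∈A) , G.closed (inj₁ e∈A)
  step e (inj₂ e∈X) = trans (app-∉ A g (λ e∈A → A∩X e e∈A e∈X))
    (sym (app-∉ S f (λ e∈S → S∩Z e e∈S (X⊆Z e∈X)))) , G.closed (inj₂ e∈X)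
  eq : iter (length A) (app A g) s ≡ iter (length A) (app S f) s
  eq = proj₁ (iter-agree (λ e → e ∈ A ⊎ e ∈ X) (app A g) (app S f) step (length A) s (inj₁ s∈A))
  ∈Z : iter (length A) (app S f) s ∈ Z
  ∈Z = subst (_∈ Z) eq (X⊆Z (G.finalImage∈ s∈A))

module _ (m : ℕ → Bool) (S : List ℕ) where

  private
    A = filterᵇ m S
    C = filterᵇ (λ s → not (m s)) S

  app-glueˡ : ∀ g h {e} → e ∈ A → app S (glue m S g h) e ≡ app A g e
  app-glueˡ g h e∈A with ∈-filterᵇ⁻ m e∈A
  ... | e∈S , me = trans (app-map _ S e∈S) (cong (if_then app A g _ else app C h _) (T-true me))

  app-glueʳ : ∀ g h {e} → e ∈ C → app S (glue m S g h) e ≡ app C h e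
  app-glueʳ g h e∈C with ∈-filterᵇ⁻ (λ s → not (m s)) e∈C
  ... | e∈S , ¬me = trans (app-map _ S e∈S) (cong (if_then app A g _ else app C h _) (Equivalence.to T-not-≡ ¬me))

  glue-restrict : ∀ f → Unique S → length f ≡ length S → glue m S (restrict S f A) (restrict S f C) ≡ f
  glue-restrict f u len = trans (map-cong-local (All.tabulate pointwise)) (map-app S f u len)
    where
    pointwise : ∀ {s} → s ∈ S →
      (if m s then app A (restrict S f A) s else app C (restrict S f C) s) ≡ app S f s
    pointwise {s} s∈S with m s in ms
    ... | true = app-map (app S f) A (∈-filterᵇ⁺ m s∈S (subst T (sym ms) _))
    ... | false = app-map (app S f) C (∈-filterᵇ⁺ (λ s → not (m s)) s∈S (subst (T ∘ not) (sym ms) _))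

  restrict-glueˡ : ∀ g h → Unique S → length g ≡ length A → restrict S (glue m S g h) A ≡ g
  restrict-glueˡ g h u len = trans (map-cong-local (All.tabulate (app-glueˡ g h)))
    (map-app A g (filterᵇ-unique m u) len)

  restrict-glueʳ : ∀ g h → Unique S → length h ≡ length C → restrict S (glue m S g h) C ≡ h
  restrict-glueʳ g h u len = trans (map-cong-local (All.tabulate (app-glueʳ g h)))
    (map-app C h (filterᵇ-unique (λ s → not (m s)) u) len)

-- Order statistics

filterᵇ-accept : ∀ {A : Set} (P : A → Bool) {x} xs → T (P x) → filterᵇ P (x ∷ xs) ≡ x ∷ filterᵇ P xs
filterᵇ-accept P xs Px rewrite T-true Px = refl

length-filterᵇ-∷ : ∀ {A : Set} (P : A → Bool) x xs → length (filterᵇ P (x ∷ xs)) ≤ suc (length (filterᵇ P xs))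
length-filterᵇ-∷ P x xs with P x
... | true = ℕ.≤-refl
... | false = ℕ.n≤1+n _

filterᵇ-inhabited : ∀ {A : Set} (P : A → Bool) xs → 0 < length (filterᵇ P xs) → ∃[ x ] (x ∈ xs × T (P x))
filterᵇ-inhabited P xs 0< with filterᵇ P xs in eq
... | x ∷ _ = x , ∈-filterᵇ⁻ P (subst (x ∈_) (sym eq) (here refl))

module _ {ζ : ℕ → ℕ} (ζ-mono : ∀ {i j} → i ≤ j → ζ i ≤ ζ j) {z : ℕ → ℚ} where

  -- The entries at positions 0 to i are below their own bounds, hence below the i-th one since `ζ`
  -- is monotone; that makes i + 1 entries. The resulting condition no longer refers to the order of
  -- the list. The offset `i₀` follows the index carried by `boundedFrom`.
  bounded⇒counts : ∀ L i₀ → (∀ i → i < length L → z (i₀ ℕ.+ i) ≡ ℕ→ℚ (ζ (i₀ ℕ.+ i))) →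
    T (boundedFrom L z i₀) → ∀ i → i < length L → i < length (filterᵇ (_≤ᵇ ζ (i₀ ℕ.+ i)) L)
  bounded⇒counts (a ∷ L) i₀ z≡ζ bd = λ
    { zero _ → subst (0 <_) (cong length (sym (accept 0))) (s≤s z≤n)
    ; (suc i) (s≤s i<) → subst (suc i <_) (cong length (sym (accept (suc i))))
        (s≤s (subst (λ k → i < length (filterᵇ (_≤ᵇ ζ k) L)) (sym (ℕ.+-suc i₀ i))
          (bounded⇒counts L (suc i₀)
            (λ i i< → subst (λ k → z k ≡ ℕ→ℚ (ζ k)) (ℕ.+-suc i₀ i) (z≡ζ (suc i) (s≤s i<)))
            (proj₂ (Equivalence.to T-∧ bd)) i i<))) }
    where
    a≤ζ : a ≤ ζ i₀
    a≤ζ = ℕ.≤ᵇ⇒≤ a (ζ i₀) (subst T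
      (trans (cong (ℕ→ℚ a ℚ.≤ᵇ_) (subst (λ k → z k ≡ ℕ→ℚ (ζ k)) (ℕ.+-identityʳ i₀) (z≡ζ 0 (s≤s z≤n)))) (ℕ→ℚ-≤ᵇ a (ζ i₀)))
      (proj₁ (Equivalence.to T-∧ bd)))
    accept : ∀ i → filterᵇ (_≤ᵇ ζ (i₀ ℕ.+ i)) (a ∷ L) ≡ a ∷ filterᵇ (_≤ᵇ ζ (i₀ ℕ.+ i)) L
    accept i = filterᵇ-accept (_≤ᵇ ζ (i₀ ℕ.+ i)) L (ℕ.≤⇒≤ᵇ (ℕ.≤-trans a≤ζ (ζ-mono (ℕ.m≤m+n i₀ i))))

  -- In a sorted list, if some entry is at most `ζ i₀` then so is the head. Dropping the head lowers
  -- every count by at most one, which matches the shift of the index.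
  counts⇒bounded : ∀ L i₀ → (∀ i → i < length L → z (i₀ ℕ.+ i) ≡ ℕ→ℚ (ζ (i₀ ℕ.+ i))) → Linked _≤_ L →
    (∀ i → i < length L → i < length (filterᵇ (_≤ᵇ ζ (i₀ ℕ.+ i)) L)) → T (boundedFrom L z i₀)
  counts⇒bounded [] i₀ z≡ζ sorted counts = _
  counts⇒bounded (a ∷ L) i₀ z≡ζ sorted counts = Equivalence.from T-∧
    (subst T (sym (trans (cong (ℕ→ℚ a ℚ.≤ᵇ_) z≡ζ₀) (ℕ→ℚ-≤ᵇ a (ζ i₀)))) (ℕ.≤⇒≤ᵇ a≤ζ) ,
     counts⇒bounded L (suc i₀)
       (λ i i< → subst (λ k → z k ≡ ℕ→ℚ (ζ k)) (ℕ.+-suc i₀ i) (z≡ζ (suc i) (s≤s i<)))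
       (Linked.tail sorted)
       (λ i i< → ℕ.≤-pred (ℕ.≤-trans
         (subst (λ k → suc i < length (filterᵇ (_≤ᵇ ζ k) (a ∷ L))) (ℕ.+-suc i₀ i) (counts (suc i) (s≤s i<)))
         (length-filterᵇ-∷ (_≤ᵇ ζ (suc i₀ ℕ.+ i)) a L))))
    where
    z≡ζ₀ : z i₀ ≡ ℕ→ℚ (ζ i₀)
    z≡ζ₀ = subst (λ k → z k ≡ ℕ→ℚ (ζ k)) (ℕ.+-identityʳ i₀) (z≡ζ 0 (s≤s z≤n))
    a≤ζ : a ≤ ζ i₀
    a≤ζ with filterᵇ-inhabited (_≤ᵇ ζ (i₀ ℕ.+ 0)) (a ∷ L) (counts 0 (s≤s z≤n))
    ... | e , e∈ , e≤ = ℕ.≤-trans (All.lookup (Linked.Linked⇒All ℕ.≤-trans ℕ.≤-refl sorted) e∈)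
      (subst (λ k → e ≤ ζ k) (ℕ.+-identityʳ i₀) (ℕ.≤ᵇ⇒≤ e _ e≤))

-- Sums over lists and over splittings

sumOver : ∀ {A : Set} → List A → (A → ℚ) → ℚ
sumOver [] f = 0ℚ
sumOver (x ∷ xs) f = f x ℚ.+ sumOver xs f

sumOver-cong : ∀ {A : Set} (xs : List A) {f g : A → ℚ} → (∀ x → x ∈ xs → f x ≡ g x) → sumOver xs f ≡ sumOver xs g
sumOver-cong [] eq = refl
sumOver-cong (x ∷ xs) eq = cong₂ ℚ._+_ (eq x (here refl)) (sumOver-cong xs (λ y → eq y ∘ there))

sumOver-map : ∀ {A B : Set} (φ : A → B) xs (f : B → ℚ) → sumOver (map φ xs) f ≡ sumOver xs (f ∘ φ)
sumOver-map φ [] f = refl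
sumOver-map φ (x ∷ xs) f = cong (f (φ x) ℚ.+_) (sumOver-map φ xs f)

sumOver-++ : ∀ {A : Set} (xs ys : List A) f → sumOver (xs ++ ys) f ≡ sumOver xs f ℚ.+ sumOver ys f
sumOver-++ [] ys f = sym (ℚ.+-identityˡ _)
sumOver-++ (x ∷ xs) ys f = trans (cong (f x ℚ.+_) (sumOver-++ xs ys f)) (sym (ℚ.+-assoc (f x) _ _))

length-concatMap-sumOver : ∀ {A B : Set} (k : A → List B) xs →
  ℕ→ℚ (length (concatMap k xs)) ≡ sumOver xs (λ x → ℕ→ℚ (length (k x)))
length-concatMap-sumOver k [] = refl
length-concatMap-sumOver k (x ∷ xs) = trans (cong ℕ→ℚ (length-++ (k x)))
  (trans (ℕ→ℚ-homo-+ (length (k x)) _) (cong (ℕ→ℚ (length (k x)) ℚ.+_) (length-concatMap-sumOver k xs)))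

module _ (s : ℕ) (S : List ℕ) where

  sumOver-splits-∷ : ∀ ψ → sumOver (splits (s ∷ S)) ψ ≡
    sumOver (splits S) (λ (A , C) → ψ (s ∷ A , C)) ℚ.+ sumOver (splits S) (λ (A , C) → ψ (A , s ∷ C))
  sumOver-splits-∷ ψ = trans (sumOver-++ (map _ (splits S)) (map _ (splits S)) ψ)
    (cong₂ ℚ._+_ (sumOver-map _ (splits S) ψ) (sumOver-map _ (splits S) ψ))

  splits-∷ˡ : ∀ {A C} → (A , C) ∈ splits S → (s ∷ A , C) ∈ splits (s ∷ S)
  splits-∷ˡ AC∈ = ∈-++⁺ˡ (∈-map⁺ (λ (A , C) → s ∷ A , C) AC∈)

  splits-∷ʳ : ∀ {A C} → (A , C) ∈ splits S → (A , s ∷ C) ∈ splits (s ∷ S)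
  splits-∷ʳ AC∈ = ∈-++⁺ʳ _ (∈-map⁺ (λ (A , C) → A , s ∷ C) AC∈)

sumOver-splits : ∀ S ψ φ →
  (∀ A C → (A , C) ∈ splits S → length A ≤ length S → ψ (A , C) ≡ φ (length A) (length C)) →
  sumOver (splits S) ψ ≡ subsetSum (length S) φ
sumOver-splits [] ψ φ eq = trans (ℚ.+-identityʳ _) (eq [] [] (here refl) z≤n)
sumOver-splits (s ∷ S) ψ φ eq = trans (sumOver-splits-∷ s S ψ) (cong₂ ℚ._+_
  (sumOver-splits S _ _ (λ A C AC∈ A≤S → eq (s ∷ A) C (splits-∷ˡ s S AC∈) (s≤s A≤S)))
  (sumOver-splits S _ _ (λ A C AC∈ A≤S → eq A (s ∷ C) (splits-∷ʳ s S AC∈) (ℕ.m≤n⇒m≤1+n A≤S))))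

-- The splitting with A = S carries the unknown of the recursion and is kept apart. The comparison
-- with φ is asked for proper subsets only, where an induction hypothesis is at hand.
sumOver-splits-proper : ∀ S ψ φ →
  (∀ A C → (A , C) ∈ splits S → length A < length S → ψ (A , C) ≡ φ (length A) (length C)) →
  sumOver (splits S) ψ ≡ ψ (S , []) ℚ.+ properSubsetSum (length S) φ
sumOver-splits-proper [] ψ φ eq = refl
sumOver-splits-proper (s ∷ S) ψ φ eq = trans (sumOver-splits-∷ s S ψ) (trans (cong₂ ℚ._+_
  (sumOver-splits-proper S _ _ (λ A C AC∈ A<S → eq (s ∷ A) C (splits-∷ˡ s S AC∈) (s≤s A<S)))
  (sumOver-splits S _ _ (λ A C AC∈ A≤S → eq A (s ∷ C) (splits-∷ʳ s S AC∈) (s≤s A≤S))))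
  (ℚ.+-assoc (ψ (s ∷ S , [])) _ _))

-- Initial and final segments of an interval

high : ℕ → ℕ → List ℕ
high v x = applyUpTo (λ i → suc (v ℕ.+ i)) (x ℕ.∸ v)

∈-interval⁺ : ∀ {e x} → 0 < e → e ≤ x → e ∈ interval x
∈-interval⁺ {suc e} _ e<x = ∈-map⁺ suc (∈-upTo⁺ e<x)

∈-interval⁻ : ∀ {e x} → e ∈ interval x → 0 < e × e ≤ x
∈-interval⁻ e∈ with ∈-map⁻ suc e∈
... | _ , i∈ , refl = s≤s z≤n , ∈-upTo⁻ i∈

∈-high⁺ : ∀ {v e x} → v < e → e ≤ x → e ∈ high v x
∈-high⁺ {v} {e} {x} v<e e≤x = subst (_∈ high v x) (ℕ.m+[n∸m]≡n v<e)
  (∈-applyUpTo⁺ (λ i → suc (v ℕ.+ i)) (ℕ.+-cancelˡ-< v _ _ (subst₂ _<_ refl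
    (sym (ℕ.m+[n∸m]≡n (ℕ.≤-trans (ℕ.<⇒≤ v<e) e≤x)))
    (subst (_≤ x) (sym (ℕ.m+[n∸m]≡n v<e)) e≤x))))

∈-high⁻ : ∀ {v e x} → v ≤ x → e ∈ high v x → v < e × e ≤ x
∈-high⁻ {v} {e} {x} v≤x e∈ with ∈-applyUpTo⁻ (λ i → suc (v ℕ.+ i)) e∈
... | i , i< , refl = s≤s (ℕ.m≤m+n v i) ,
  subst (v ℕ.+ i <_) (ℕ.m+[n∸m]≡n v≤x) (ℕ.+-monoʳ-< v i<)

finSet-interval : ∀ x → IsFinSet (interval x)
finSet-interval x = Linked.map⁺ (Linked.applyUpTo⁺₂ id x (λ i → ℕ.n<1+n (suc i)))

finSet-high : ∀ v x → IsFinSet (high v x)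
finSet-high v x = Linked.applyUpTo⁺₂ (λ i → suc (v ℕ.+ i)) (x ℕ.∸ v)
  (λ i → s≤s (ℕ.+-monoʳ-< v (ℕ.n<1+n i)))

length-interval : ∀ x → length (interval x) ≡ x
length-interval x = trans (length-map suc (upTo x)) (length-applyUpTo id x)

interval-⊆ : ∀ {v x e} → v ≤ x → e ∈ interval v → e ∈ interval x
interval-⊆ v≤x e∈ = let (0<e , e≤v) = ∈-interval⁻ e∈ in ∈-interval⁺ 0<e (ℕ.≤-trans e≤v v≤x)

high-⊆ : ∀ {v x e} → v ≤ x → e ∈ high v x → e ∈ interval x
high-⊆ v≤x e∈ = let (v<e , e≤x) = ∈-high⁻ v≤x e∈ in ∈-interval⁺ (ℕ.≤-<-trans z≤n v<e) e≤x

interval∩high : ∀ {v x} → v ≤ x → Disjoint (interval v) (high v x)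
interval∩high v≤x e e∈ e∈′ = ℕ.<⇒≱ (proj₁ (∈-high⁻ v≤x e∈′)) (proj₂ (∈-interval⁻ e∈))

interval∪high : ∀ {v x} → v ≤ x → IsUnion (interval v) (high v x) (interval x)
interval∪high {v} {x} v≤x e = mk⇔ to λ { (inj₁ e∈) → interval-⊆ v≤x e∈ ; (inj₂ e∈) → high-⊆ v≤x e∈ }
  where
  to : e ∈ interval x → e ∈ interval v ⊎ e ∈ high v x
  to e∈ with e ℕ.≤? v
  ... | yes e≤v = inj₁ (∈-interval⁺ (proj₁ (∈-interval⁻ e∈)) e≤v)
  ... | no e≰v = inj₂ (∈-high⁺ (ℕ.≰⇒> e≰v) (proj₂ (∈-interval⁻ e∈)))

-- Binomial classes with target {1, …, x}

module Class (B : BinomialClass) {p : ℕ → Poly} (counting : HasCountingPolys B p) (p₀ : p 0 ≈ₚ 1ℚ ∷ []) where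

  eval-p₀ : ∀ r → eval (p 0) r ≡ 1ℚ
  eval-p₀ r = trans (eval-cong (p 0) (1ℚ ∷ []) r p₀)
    (trans (cong (1ℚ ℚ.+_) (ℚ.*-zeroʳ r)) (ℚ.+-identityʳ 1ℚ))

  -- The only candidate on the empty domain is the empty map, and p_0 = 1 says that exactly one
  -- candidate belongs to the class.
  F-empty : ∀ {Y} → IsFinSet Y → T (F B [] Y [])
  F-empty {Y} finY = holds (ℕ→ℚ-injective (trans (counting [] Y [] finY (λ _ ())) (eval-p₀ _)))
    where
    holds : count B [] Y ≡ 1 → T (F B [] Y [])
    holds eq with F B [] Y []
    holds () | false
    ... | true = _

  maps : List ℕ → List ℕ → List (List ℕ)
  maps S X = filterᵇ (F B S X) (cands (length S) (S ++ X))

  ∈-maps⁻ : ∀ S X {f} → f ∈ maps S X → T (F B S X f)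
  ∈-maps⁻ S X f∈ = proj₂ (∈-filterᵇ⁻ (F B S X) {xs = cands (length S) (S ++ X)} f∈)

  ∈-cands : ∀ {S X f} → IsFinSet S → IsFinSet X → Disjoint S X → T (F B S X f) →
    f ∈ cands (length S) (S ++ X)
  ∈-cands {S} {X} {f} finS finX S∩X Ff =
    let (len , f⊆ , _) = F-reluctant B S X f finS finX S∩X Ff in
    ∈-cands⁺ (length S) len (All.map (λ { (inj₁ e∈) → ∈-++⁺ˡ e∈ ; (inj₂ e∈) → ∈-++⁺ʳ S e∈ }) f⊆)

  unique-cands-++ : ∀ {S X} → IsFinSet S → IsFinSet X → Disjoint S X → Unique (cands (length S) (S ++ X))
  unique-cands-++ {S} finS finX S∩X = unique-cands (length S)
    (Unique.++⁺ (finSet-unique finS) (finSet-unique finX) (λ (e∈S , e∈X) → S∩X _ e∈S e∈X))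

  module Target (x : ℕ) where

    X = interval x

    record Admissible (S : List ℕ) : Set where
      constructor _,_
      field
        finite : IsFinSet S
        disjoint : Disjoint S X

    open Admissible

    admissible-filterᵇ : ∀ m {S} → Admissible S → Admissible (filterᵇ m S)
    admissible-filterᵇ m (finS , S∩X) = finSet-filterᵇ m finS , λ e → S∩X e ∘ proj₁ ∘ ∈-filterᵇ⁻ m

    reluctant : ∀ {S f} → Admissible S → T (F B S X f) → IsReluctant S X f
    reluctant (finS , S∩X) = F-reluctant B _ X _ finS (finSet-interval x) S∩X

    module _ {v : ℕ} (v≤x : v ≤ x) where

      ∩low : ∀ {S} → Admissible S → Disjoint S (interval v)
      ∩low adm e e∈S = disjoint adm e e∈S ∘ interval-⊆ v≤x

      ∩high : ∀ {S} → Admissible S → Disjoint S (high v x)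
      ∩high adm e e∈S = disjoint adm e e∈S ∘ high-⊆ v≤x

      reluctant-low : ∀ {S f} → Admissible S → T (F B S (interval v) f) → IsReluctant S (interval v) f
      reluctant-low adm = F-reluctant B _ _ _ (finite adm) (finSet-interval v) (∩low adm)

      reluctant-high : ∀ {S f} → Admissible S → T (F B S (high v x) f) → IsReluctant S (high v x) f
      reluctant-high adm = F-reluctant B _ _ _ (finite adm) (finSet-high v x) (∩high adm)

      -- `F-split` tests whether a final image lies in {1,...,v}; final images are positive, so this
      -- is the test against v. The parts enter through equations because they come from elsewhere:
      -- from a splitting of S, or as all of S.
      decompose : ∀ {S f} → Admissible S → T (F B S X f) → ∀ {A C} →
        filterᵇ (λ s → finalImage S f s ≤ᵇ v) S ≡ A →
        filterᵇ (λ s → not (finalImage S f s ≤ᵇ v)) S ≡ C →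
        T (F B A (interval v) (restrict S f A)) × T (F B C (high v x) (restrict S f C))
      decompose {S} {f} adm Ff A≡ C≡ =
        subst (λ A → T (F B A (interval v) (restrict S f A))) (trans (filterᵇ-cong _ _ S same) A≡) (proj₁ split) ,
        subst (λ C → T (F B C (high v x) (restrict S f C))) (trans (filterᵇ-cong _ _ S (λ s → cong not ∘ same s)) C≡) (proj₂ split)
        where
        split = F-split B S (interval v) (high v x) X (finite adm) (finSet-interval v) (finSet-high v x)
          (finSet-interval x) (∩low adm) (∩high adm) (interval∩high v≤x) (interval∪high v≤x) f Ff
        same : ∀ s → s ∈ S → (finalImage S f s ∈ᵇ interval v) ≡ (finalImage S f s ≤ᵇ v)
        same s s∈S = T⇔⇒≡ (ℕ.≤⇒≤ᵇ {finalImage S f s} ∘ proj₂ ∘ ∈-interval⁻ ∘ ∈ᵇ⇒∈ (interval v))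
          (∈⇒∈ᵇ ∘ ∈-interval⁺ (proj₁ (∈-interval⁻ (Reluctant.finalImage∈ (disjoint adm) (reluctant adm Ff) s∈S))) ∘ ℕ.≤ᵇ⇒≤ _ v)

      glue-F : ∀ m {S g h A C} → Admissible S → filterᵇ m S ≡ A → filterᵇ (λ s → not (m s)) S ≡ C →
        T (F B A (interval v) g) → T (F B C (high v x) h) → T (F B S X (glue m S g h))
      glue-F m {S} {g} {h} adm refl refl = F-glue B S (interval v) (high v x) X (finite adm) (finSet-interval v) (finSet-high v x)
          (finSet-interval x) (∩low adm) (∩high adm) (interval∩high v≤x) (interval∪high v≤x) m g h

      -- The binomial bijection with an empty second part, filled by the empty map. Together with
      -- `full⇒low` it identifies the class on A with target {1,...,v} with the maps to X whose
      -- final images are at most v; `ord` counts maps to X, whereas gluing needs the smaller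
      -- target.
      low⇒full : ∀ {A g} → Admissible A → T (F B A (interval v) g) → T (F B A X g)
      low⇒full {A} {g} adm Fg = subst (T ∘ F B A X) glue≡g
        (glue-F (λ _ → true) adm all none Fg (F-empty (finSet-high v x)))
        where
        all : filterᵇ (λ _ → true) A ≡ A
        all = filterᵇ-all _ A (λ _ _ → _)
        none : filterᵇ (λ _ → false) A ≡ []
        none = filterᵇ-none _ A (λ _ _ ())
        glue≡g : glue (λ _ → true) A g [] ≡ g
        glue≡g = trans (cong (λ A′ → map (app A′ g) A) all)
          (map-app A g (finSet-unique (finite adm)) (proj₁ (reluctant-low adm Fg)))

      full⇒low : ∀ {A g} → Admissible A → T (F B A X g) → (∀ s → s ∈ A → finalImage A g s ≤ v) →
        T (F B A (interval v) g)
      full⇒low {A} {g} adm Fg low = subst (T ∘ F B A (interval v))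
        (map-app A g (finSet-unique (finite adm)) (proj₁ (reluctant adm Fg)))
        (proj₁ (decompose adm Fg (filterᵇ-all _ A (λ s → ℕ.≤⇒≤ᵇ ∘ low s)) refl))

      module _ (m : ℕ → Bool) {S g h A C} (adm : Admissible S)
        (A≡ : filterᵇ m S ≡ A) (C≡ : filterᵇ (λ s → not (m s)) S ≡ C)
        (Fg : T (F B A (interval v) g)) (Fh : T (F B C (high v x) h)) where

        private
          f = glue m S g h
          Ff = glue-F m adm A≡ C≡ Fg Fh
          admA = subst Admissible A≡ (admissible-filterᵇ m adm)
          admC = subst Admissible C≡ (admissible-filterᵇ (λ s → not (m s)) adm)

          ⊆S : ∀ {P A e} → filterᵇ P S ≡ A → e ∈ A → e ∈ S
          ⊆S {P} refl = proj₁ ∘ ∈-filterᵇ⁻ P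

          app-f-A : ∀ {A} → filterᵇ m S ≡ A → ∀ {e} → e ∈ A → app S f e ≡ app A g e
          app-f-A refl = app-glueˡ m S g h

          app-f-C : ∀ {C} → filterᵇ (λ s → not (m s)) S ≡ C → ∀ {e} → e ∈ C → app S f e ≡ app C h e
          app-f-C refl = app-glueʳ m S g h

        finalImage-A : ∀ {s} → s ∈ A → finalImage S f s ≡ finalImage A g s
        finalImage-A = finalImage-restrict (disjoint adm) (reluctant adm Ff) (∩low admA) (reluctant-low admA Fg)
          (⊆S A≡) (interval-⊆ v≤x) (app-f-A A≡)

        finalImage-C : ∀ {s} → s ∈ C → finalImage S f s ≡ finalImage C h s
        finalImage-C = finalImage-restrict (disjoint adm) (reluctant adm Ff) (∩high admC) (reluctant-high admC Fh)
          (⊆S C≡) (high-⊆ v≤x) (app-f-C C≡)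

        -- Elements of A end in {1,...,v} and elements of C in {v+1,...,x}, so the threshold v reads
        -- the mask back from the glued map.
        finalImage≤ᵇ : ∀ s → s ∈ S → (finalImage S f s ≤ᵇ v) ≡ m s
        finalImage≤ᵇ s s∈S with m s in ms
        ... | true = T-true (ℕ.≤⇒≤ᵇ (subst (_≤ v) (sym (finalImage-A s∈A))
            (proj₂ (∈-interval⁻ (Reluctant.finalImage∈ (∩low admA) (reluctant-low admA Fg) s∈A)))))
          where s∈A = subst (s ∈_) A≡ (∈-filterᵇ⁺ m s∈S (subst T (sym ms) _))
        ... | false = ¬T-false (λ t → ℕ.<⇒≱ (subst (v <_) (sym (finalImage-C s∈C))
            (proj₁ (∈-high⁻ v≤x (Reluctant.finalImage∈ (∩high admC) (reluctant-high admC Fh) s∈C)))) (ℕ.≤ᵇ⇒≤ _ v t))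
          where s∈C = subst (s ∈_) C≡ (∈-filterᵇ⁺ (λ s → not (m s)) s∈S (subst (T ∘ not) (sym ms) _))

        -- Elements of C end above v and are never counted at a threshold u ≤ v, while those of A
        -- keep their final images.
        finalImages-below : ∀ {u} → u ≤ v →
          length (filterᵇ (λ s → finalImage S f s ≤ᵇ u) S) ≡ length (filterᵇ (λ s → finalImage A g s ≤ᵇ u) A)
        finalImages-below {u} u≤v = cong length (begin
          filterᵇ (λ s → finalImage S f s ≤ᵇ u) S                ≡⟨ filterᵇ-filterᵇ _ m S (λ s s∈S t →
            subst T (finalImage≤ᵇ s s∈S) (ℕ.≤⇒≤ᵇ {finalImage S f s} (ℕ.≤-trans (ℕ.≤ᵇ⇒≤ _ u t) u≤v))) ⟨
          filterᵇ (λ s → finalImage S f s ≤ᵇ u) (filterᵇ m S)    ≡⟨ cong (filterᵇ _) A≡ ⟩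
          filterᵇ (λ s → finalImage S f s ≤ᵇ u) A                ≡⟨ filterᵇ-cong _ _ A (λ s s∈A → cong (_≤ᵇ u) (finalImage-A s∈A)) ⟩
          filterᵇ (λ s → finalImage A g s ≤ᵇ u) A                ∎)

    -- Order statistics and the decomposition of F(S,X) by type

    module OrderStatistics {ζ : ℕ → ℕ} (ζ-mono : ∀ {i j} → i ≤ j → ζ i ≤ ζ j) (ζ≤x : ∀ i → ζ i ≤ x)
        {z : ℕ → ℚ} {n : ℕ} (z≡ζ : ∀ i → i < n → z i ≡ ℕ→ℚ (ζ i)) where

        below : List ℕ → List ℕ → ℕ → ℕ
        below S f u = length (filterᵇ (λ s → finalImage S f s ≤ᵇ u) S)

        below-mono : ∀ S f {u v} → u ≤ v → below S f u ≤ below S f v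
        below-mono S f u≤v = length-filterᵇ-mono _ _ S (λ s _ t → ℕ.≤⇒≤ᵇ {finalImage S f s} (ℕ.≤-trans (ℕ.≤ᵇ⇒≤ _ _ t) u≤v))

        -- The sort-free form of x_(i) ≤ ζ i for all i < k.
        Bounded : ℕ → List ℕ → List ℕ → Set
        Bounded k S f = ∀ i → i < k → i < below S f (ζ i)

        below-sort : ∀ S f u → length (filterᵇ (_≤ᵇ u) (orderStats S f)) ≡ below S f u
        below-sort S f u = trans (length-filterᵇ-↭ (_≤ᵇ u) (sort-↭ (map (finalImage S f) S)))
          (length-filterᵇ-map (finalImage S f) (_≤ᵇ u) S)

        length-orderStats : ∀ S f → length (orderStats S f) ≡ length S
        length-orderStats S f = trans (↭-length (sort-↭ (map (finalImage S f) S))) (length-map (finalImage S f) S)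

        module _ {S : List ℕ} (S≤n : length S ≤ n) (f : List ℕ) where

          private
            z≡ζ′ : ∀ i → i < length (orderStats S f) → z i ≡ ℕ→ℚ (ζ i)
            z≡ζ′ i i< = z≡ζ i (ℕ.<-≤-trans i< (ℕ.≤-trans (ℕ.≤-reflexive (length-orderStats S f)) S≤n))

          boundedFrom⇒Bounded : T (boundedFrom (orderStats S f) z 0) → Bounded (length S) S f
          boundedFrom⇒Bounded bd i i< = subst (i <_) (below-sort S f (ζ i))
            (bounded⇒counts ζ-mono (orderStats S f) 0 z≡ζ′ bd i (subst (i <_) (sym (length-orderStats S f)) i<))

          Bounded⇒boundedFrom : Bounded (length S) S f → T (boundedFrom (orderStats S f) z 0)
          Bounded⇒boundedFrom bd = counts⇒bounded ζ-mono (orderStats S f) 0 z≡ζ′ (sort-↗ (map (finalImage S f) S))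
            (λ i i< → subst (i <_) (sym (below-sort S f (ζ i))) (bd i (subst (i <_) (length-orderStats S f) i<)))

        -- At the last index |S| - 1 the count must exceed |S| - 1, hence includes every element.
        -- This is what places a bounded map on A in the class with target {1,...,ζ |A|}.
        Bounded⇒≤ : ∀ {S f} → Bounded (length S) S f → ∀ s → s ∈ S → finalImage S f s ≤ ζ (length S)
        Bounded⇒≤ {S@(_ ∷ S′)} {f} bd s s∈S = ℕ.≤-trans
          (ℕ.≤ᵇ⇒≤ _ (ζ (length S′)) (length-filterᵇ-maximal (λ s → finalImage S f s ≤ᵇ ζ (length S′)) S (bd (length S′) ℕ.≤-refl) s s∈S))
          (ζ-mono (ℕ.n≤1+n (length S′)))

        orderedMaps : List ℕ → List (List ℕ)
        orderedMaps S = filterᵇ (λ f → F B S X f ∧ boundedFrom (orderStats S f) z 0) (cands (length S) (S ++ X))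

        -- f has type A when A = {s : final image ≤ z_|A|} and the order statistics of index < |A|
        -- obey the bounds; |A| is then the least j whose order statistic violates its bound.
        HasType : List ℕ → List ℕ → List ℕ → Set
        HasType S f A = filterᵇ (λ s → finalImage S f s ≤ᵇ ζ (length A)) S ≡ A × Bounded (length A) S f

        -- Exactly |A| elements have final image at most `ζ (length A)`, whereas boundedness for a
        -- longer A′ would demand more than |A| at that index.
        type-≮ : ∀ S f {A A′} → HasType S f A → HasType S f A′ → ¬ length A < length A′
        type-≮ S f {A} {A′} (eq , _) (_ , bd) lt =
          ℕ.<-irrefl (sym (cong length eq)) (bd (length A) lt)

        type-unique : ∀ S f {A A′} → HasType S f A → HasType S f A′ → A ≡ A′
        type-unique S f {A} {A′} τ τ′ = trans (sym (proj₁ τ))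
          (trans (cong (λ k → filterᵇ (λ s → finalImage S f s ≤ᵇ ζ k) S)
            (ℕ.≤-antisym (ℕ.≮⇒≥ (type-≮ S f τ′ τ)) (ℕ.≮⇒≥ (type-≮ S f τ τ′)))) (proj₁ τ′))

        least-violation : ∀ S f k → Bounded k S f ⊎ ∃[ j ] (below S f (ζ j) ≤ j × Bounded j S f)
        least-violation S f zero = inj₁ (λ _ ())
        least-violation S f (suc k) with least-violation S f k
        ... | inj₂ found = inj₂ found
        ... | inj₁ bd with k ℕ.<? below S f (ζ k)
        ...   | no ≮ = inj₂ (k , ℕ.≮⇒≥ ≮ , bd)
        ...   | yes k< = inj₁ extend
          where
          extend : Bounded (suc k) S f
          extend i (s≤s i≤k) with ℕ.m≤n⇒m<n∨m≡n i≤k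
          ... | inj₁ i<k = bd i i<k
          ... | inj₂ refl = k<

        -- At the least violation j the count is at most j. The bound at j - 1 together with the
        -- monotonicity of `ζ` makes it at least j, so the elements counted form a set of size
        -- exactly j.
        type-exists : ∀ S f → ∃[ A ] HasType S f A
        type-exists S f = let (j , ≤j , bd) = violation in _ , typed j ≤j bd
          where
          violation : ∃[ j ] (below S f (ζ j) ≤ j × Bounded j S f)
          violation with least-violation S f (length S)
          -- Without a violation below |S| the index |S| itself serves, since no count exceeds |S|.
          ... | inj₁ bd = length S , length-filterᵇ _ S , bd
          ... | inj₂ found = found

          ≤below : ∀ j → Bounded j S f → j ≤ below S f (ζ j)
          ≤below zero bd = z≤n
          ≤below (suc j) bd = ℕ.<-≤-trans (bd j ℕ.≤-refl) (below-mono S f (ζ-mono (ℕ.n≤1+n j)))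

          typed : ∀ j → below S f (ζ j) ≤ j → Bounded j S f →
            HasType S f (filterᵇ (λ s → finalImage S f s ≤ᵇ ζ j) S)
          typed j ≤j bd = subst (λ k → filterᵇ (λ s → finalImage S f s ≤ᵇ ζ k) S ≡ filterᵇ (λ s → finalImage S f s ≤ᵇ ζ j) S × Bounded k S f)
            (ℕ.≤-antisym (≤below j bd) ≤j) (refl , bd)

        -- The maps of type A, each assembled from its two restrictions. The first factor ranges
        -- over maps to all of X, so that the length of its list is `ord B A X z` by definition.
        block : List ℕ → List ℕ × List ℕ → List (List ℕ)
        block S (A , C) = concatMap (λ g → map (glue (_∈ᵇ A) S g) (maps C (high (ζ (length A)) x))) (orderedMaps A)

        length-block : ∀ S A C → length (block S (A , C)) ≡ ord B A X z ℕ.* count B C (high (ζ (length A)) x)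
        length-block S A C = length-concatMap-const _ _
          (λ g → length-map (glue (_∈ᵇ A) S g) (maps C (high (ζ (length A)) x))) (orderedMaps A)

        module _ {S : List ℕ} (adm : Admissible S) (S≤n : length S ≤ n) where

          private
            unique-S = finSet-unique (finite adm)

          module _ {A C : List ℕ} (AC∈ : (A , C) ∈ splits S) where

            private
              v = ζ (length A)
              v≤x = ζ≤x (length A)
              A≡ = proj₁ (splits-mask unique-S AC∈)
              C≡ = proj₂ (splits-mask unique-S AC∈)
              admA = subst Admissible A≡ (admissible-filterᵇ (_∈ᵇ A) adm)
              admC = subst Admissible C≡ (admissible-filterᵇ (λ s → not (s ∈ᵇ A)) adm)
              A≤n = ℕ.≤-trans (subst (λ A′ → length A′ ≤ length S) A≡ (length-filterᵇ (_∈ᵇ A) S)) S≤n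

            ∈-orderedMaps⁻ : ∀ {g} → g ∈ orderedMaps A → T (F B A (interval v) g) × Bounded (length A) A g
            ∈-orderedMaps⁻ {g} g∈ =
              let (Fg , bd) = Equivalence.to T-∧ (proj₂ (∈-filterᵇ⁻ (λ f → F B A X f ∧ boundedFrom (orderStats A f) z 0)
                    {xs = cands (length A) (A ++ X)} g∈))
                  bd′ = boundedFrom⇒Bounded A≤n g bd in
              full⇒low v≤x admA Fg (Bounded⇒≤ bd′) , bd′

            ∈-orderedMaps⁺ : ∀ {g} → T (F B A (interval v) g) → Bounded (length A) A g → g ∈ orderedMaps A
            ∈-orderedMaps⁺ {g} Fg bd = ∈-filterᵇ⁺ (λ f → F B A X f ∧ boundedFrom (orderStats A f) z 0)
              (∈-cands (finite admA) (finSet-interval x) (disjoint admA) FgX)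
              (Equivalence.from T-∧ (FgX , Bounded⇒boundedFrom A≤n g bd))
              where FgX = low⇒full v≤x admA Fg

            ∈-maps⁺ : ∀ {h} → T (F B C (high v x) h) → h ∈ maps C (high v x)
            ∈-maps⁺ Fh = ∈-filterᵇ⁺ (F B C (high v x)) (∈-cands (finite admC) (finSet-high v x) (∩high v≤x admC) Fh) Fh

            ∈-block⁻ : ∀ {f} → f ∈ block S (A , C) → T (F B S X f) × HasType S f A
            ∈-block⁻ {f} f∈ with ∈-concatMap-elim _ (orderedMaps A) f∈
            ... | g , g∈ , f∈′ with ∈-map⁻ (glue (_∈ᵇ A) S g) f∈′
            ...   | h , h∈ , refl =
              let (Fg , bd) = ∈-orderedMaps⁻ g∈ ; Fh = ∈-maps⁻ C (high v x) h∈ in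
              glue-F v≤x (_∈ᵇ A) adm A≡ C≡ Fg Fh ,
              trans (filterᵇ-cong _ _ S (finalImage≤ᵇ v≤x (_∈ᵇ A) adm A≡ C≡ Fg Fh)) A≡ ,
              λ i i< → subst (i <_) (sym (finalImages-below v≤x (_∈ᵇ A) adm A≡ C≡ Fg Fh (ζ-mono (ℕ.<⇒≤ i<)))) (bd i i<)

            unique-block : Unique (block S (A , C))
            unique-block = unique-concatMap _
              (λ g g∈ → unique-map _ (λ h h′ h∈ h′∈ eq → trans (sym (h-of g∈ h∈)) (trans (cong (λ f → restrict S f C) eq) (h-of g∈ h′∈)))
                (filterᵇ-unique _ (unique-cands-++ (finite admC) (finSet-high v x) (∩high v≤x admC))))
              (λ g g′ f g∈ g′∈ f∈ f∈′ →
                let (h , h∈ , eq) = ∈-map⁻ (glue (_∈ᵇ A) S g) f∈ ; (h′ , h′∈ , eq′) = ∈-map⁻ (glue (_∈ᵇ A) S g′) f∈′ in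
                trans (sym (g-of g∈ h)) (trans (cong (λ f → restrict S f A) (trans (sym eq) eq′)) (g-of g′∈ h′)))
              (filterᵇ-unique _ (unique-cands-++ (finite admA) (finSet-interval x) (disjoint admA)))
              where
              g-of : ∀ {g} → g ∈ orderedMaps A → ∀ h → restrict S (glue (_∈ᵇ A) S g h) A ≡ g
              g-of {g} g∈ h = subst (λ A′ → length g ≡ length A′ → restrict S (glue (_∈ᵇ A) S g h) A′ ≡ g) A≡
                (restrict-glueˡ (_∈ᵇ A) S g h unique-S) (proj₁ (reluctant-low v≤x admA (proj₁ (∈-orderedMaps⁻ g∈))))
              h-of : ∀ {g h} → g ∈ orderedMaps A → h ∈ maps C (high v x) → restrict S (glue (_∈ᵇ A) S g h) C ≡ h
              h-of {g} {h} _ h∈ = subst (λ C′ → length h ≡ length C′ → restrict S (glue (_∈ᵇ A) S g h) C′ ≡ h) C≡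
                (restrict-glueʳ (_∈ᵇ A) S g h unique-S) (proj₁ (reluctant-high v≤x admC (∈-maps⁻ C (high v x) h∈)))

            ∈-block⁺ : ∀ {f} → T (F B S X f) → HasType S f A →
              filterᵇ (λ s → not (finalImage S f s ≤ᵇ v)) S ≡ C → f ∈ block S (A , C)
            ∈-block⁺ {f} Ff (A≡′ , bd) C≡′ = ∈-concatMap-intro _
              (∈-orderedMaps⁺ Fg (λ i i< → subst (i <_)
                (trans (cong (λ f → below S f (ζ i)) (sym glue≡f)) (finalImages-below v≤x (_∈ᵇ A) adm A≡ C≡ Fg Fh (ζ-mono (ℕ.<⇒≤ i<))))
                (bd i i<)))
              (subst (_∈ map (glue (_∈ᵇ A) S (restrict S f A)) (maps C (high v x))) glue≡f
                (∈-map⁺ (glue (_∈ᵇ A) S (restrict S f A)) (∈-maps⁺ Fh)))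
              where
              Fg = proj₁ (decompose v≤x adm Ff A≡′ C≡′)
              Fh = proj₂ (decompose v≤x adm Ff A≡′ C≡′)
              glue≡f : glue (_∈ᵇ A) S (restrict S f A) (restrict S f C) ≡ f
              glue≡f = subst₂ (λ A′ C′ → glue (_∈ᵇ A) S (restrict S f A′) (restrict S f C′) ≡ f) A≡ C≡
                (glue-restrict (_∈ᵇ A) S f unique-S (proj₁ (reluctant adm Ff)))

          -- Every map has exactly one type, and the type determines the splitting, so the blocks
          -- partition F(S,X). Within a block the two restrictions recover the factors, so nothing
          -- is listed twice.
          count≡blocks : count B S X ≡ length (concatMap (block S) (splits S))
          count≡blocks = unique-same-length
            (filterᵇ-unique _ (unique-cands-++ (finite adm) (finSet-interval x) (disjoint adm)))
            (unique-concatMap (block S) (λ _ → unique-block)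
              (λ (A , C) (A′ , C′) f AC∈ AC∈′ f∈ f∈′ → same-split AC∈ AC∈′
                (type-unique S f (proj₂ (∈-block⁻ AC∈ f∈)) (proj₂ (∈-block⁻ AC∈′ f∈′))))
              (unique-splits unique-S))
            to from
            where
            same-split : ∀ {A C A′ C′} → (A , C) ∈ splits S → (A′ , C′) ∈ splits S → A ≡ A′ → (A , C) ≡ (A′ , C′)
            same-split AC∈ AC∈′ refl = cong (_ ,_)
              (trans (sym (proj₂ (splits-mask unique-S AC∈))) (proj₂ (splits-mask unique-S AC∈′)))

            to : ∀ f → f ∈ maps S X → f ∈ concatMap (block S) (splits S)
            to f f∈ =
              let (A , τ) = type-exists S f
                  μ = λ s → finalImage S f s ≤ᵇ ζ (length A)
                  AC∈ = subst (λ A′ → (A′ , filterᵇ (λ s → not (μ s)) S) ∈ splits S) (proj₁ τ) (splits-complete μ S) in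
              ∈-concatMap-intro (block S) AC∈
                (∈-block⁺ AC∈ (∈-maps⁻ S X f∈) τ refl)

            from : ∀ f → f ∈ concatMap (block S) (splits S) → f ∈ maps S X
            from f f∈ = let (AC , AC∈ , f∈′) = ∈-concatMap-elim (block S) (splits S) f∈
                            Ff = proj₁ (∈-block⁻ AC∈ f∈′) in
              ∈-filterᵇ⁺ (F B S X) (∈-cands (finite adm) (finSet-interval x) (disjoint adm) Ff) Ff

          count-recursion : eval (p (length S)) (ℕ→ℚ x)
            ≡ sumOver (splits S) (λ (A , C) → eval (p (length C)) (ℕ→ℚ (x ℕ.∸ ζ (length A))) ℚ.* ℕ→ℚ (ord B A X z))
          count-recursion = begin
            eval (p (length S)) (ℕ→ℚ x)                      ≡⟨ cong (λ k → eval (p (length S)) (ℕ→ℚ k)) (length-interval x) ⟨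
            eval (p (length S)) (ℕ→ℚ (length X))             ≡⟨ counting S X (finite adm) (finSet-interval x) (disjoint adm) ⟨
            ℕ→ℚ (count B S X)                                ≡⟨ cong ℕ→ℚ count≡blocks ⟩
            ℕ→ℚ (length (concatMap (block S) (splits S)))    ≡⟨ length-concatMap-sumOver (block S) (splits S) ⟩
            sumOver (splits S) (λ AC → ℕ→ℚ (length (block S AC))) ≡⟨ sumOver-cong (splits S) block-size ⟩
            sumOver (splits S) (λ (A , C) → eval (p (length C)) (ℕ→ℚ (x ℕ.∸ ζ (length A))) ℚ.* ℕ→ℚ (ord B A X z)) ∎
            where
            block-size : ∀ AC → AC ∈ splits S → ℕ→ℚ (length (block S AC))
              ≡ eval (p (length (proj₂ AC))) (ℕ→ℚ (x ℕ.∸ ζ (length (proj₁ AC)))) ℚ.* ℕ→ℚ (ord B (proj₁ AC) X z)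
            block-size (A , C) AC∈ = begin
              ℕ→ℚ (length (block S (A , C)))                 ≡⟨ cong ℕ→ℚ (length-block S A C) ⟩
              ℕ→ℚ (ord B A X z ℕ.* count B C (high (ζ (length A)) x)) ≡⟨ ℕ→ℚ-homo-* (ord B A X z) _ ⟩
              ℕ→ℚ (ord B A X z) ℚ.* ℕ→ℚ (count B C (high (ζ (length A)) x)) ≡⟨ ℚ.*-comm (ℕ→ℚ (ord B A X z)) _ ⟩
              ℕ→ℚ (count B C (high (ζ (length A)) x)) ℚ.* ℕ→ℚ (ord B A X z)
                ≡⟨ cong (ℚ._* ℕ→ℚ (ord B A X z)) (counting C (high (ζ (length A)) x) (finite admC) (finSet-high _ x) (∩high (ζ≤x (length A)) admC)) ⟩
              eval (p (length C)) (ℕ→ℚ (length (high (ζ (length A)) x))) ℚ.* ℕ→ℚ (ord B A X z)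
                ≡⟨ cong (λ k → eval (p (length C)) (ℕ→ℚ k) ℚ.* ℕ→ℚ (ord B A X z)) (length-applyUpTo _ (x ℕ.∸ ζ (length A))) ⟩
              eval (p (length C)) (ℕ→ℚ (x ℕ.∸ ζ (length A))) ℚ.* ℕ→ℚ (ord B A X z) ∎
              where
              admC = subst Admissible (proj₂ (splits-mask unique-S AC∈)) (admissible-filterᵇ (λ s → not (s ∈ᵇ A)) adm)

        -- From the counting recursion to the interpolating polynomial

        module _ (w : ℕ → ℚ) (w≡ : ∀ i → i < n → ℕ→ℚ (x ℕ.∸ ζ i) ≡ w i) where

          private
            total : ℕ → ℚ
            total m = eval (p m) (ℕ→ℚ x)

            kernel : ℕ → ℕ → ℚ
            kernel i j = eval (p j) (w i)

            G : ℕ → ℚ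
            G = solution total kernel

          -- Strong induction on |S|: as p_0 = 1, the term A = S of the counting recursion is `ord`
          -- of S itself, and the proper subsets determine it. In particular `ord` depends on S only
          -- through its size.
          ord≡solution : ∀ {S} → Admissible S → length S ≤ n → ℕ→ℚ (ord B S X z) ≡ G (length S)
          ord≡solution {S} adm S≤n = induct (suc (length S)) adm S≤n ℕ.≤-refl
            where
            induct : ∀ k {S} → Admissible S → length S ≤ n → length S < k → ℕ→ℚ (ord B S X z) ≡ G (length S)
            induct (suc k) {S} adm S≤n (s≤s S≤k) = begin
              o                            ≡⟨ ℚ-cancel o rest ⟩
              o ℚ.+ rest ℚ.- rest          ≡⟨ cong (ℚ._- rest) identity ⟨
              eval (p (length S)) (ℕ→ℚ x) ℚ.- rest ≡⟨ solution-rec total kernel (length S) ⟨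
              G (length S)                 ∎
              where
              o = ℕ→ℚ (ord B S X z)
              rest = properSubsetSum (length S) (λ i j → eval (p j) (w i) ℚ.* G i)
              ℚ-cancel : ∀ a b → a ≡ a ℚ.+ b ℚ.- b
              ℚ-cancel = solve 2 (λ a b → a := (a :+ b) :+ (:- b)) refl
              proper : ∀ A C → (A , C) ∈ splits S → length A < length S →
                eval (p (length C)) (ℕ→ℚ (x ℕ.∸ ζ (length A))) ℚ.* ℕ→ℚ (ord B A X z)
                ≡ eval (p (length C)) (w (length A)) ℚ.* G (length A)
              proper A C AC∈ A<S = cong₂ (λ u g → eval (p (length C)) u ℚ.* g)
                (w≡ (length A) (ℕ.<-≤-trans A<S S≤n))
                (induct k admA (ℕ.≤-trans (ℕ.<⇒≤ A<S) S≤n) (ℕ.<-≤-trans A<S S≤k))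
                where admA = subst Admissible (proj₁ (splits-mask (finSet-unique (finite adm)) AC∈)) (admissible-filterᵇ (_∈ᵇ A) adm)
              identity : eval (p (length S)) (ℕ→ℚ x) ≡ o ℚ.+ rest
              identity = begin
                eval (p (length S)) (ℕ→ℚ x) ≡⟨ count-recursion adm S≤n ⟩
                sumOver (splits S) (λ (A , C) → eval (p (length C)) (ℕ→ℚ (x ℕ.∸ ζ (length A))) ℚ.* ℕ→ℚ (ord B A X z))
                  ≡⟨ sumOver-splits-proper S _ _ proper ⟩
                eval (p 0) _ ℚ.* o ℚ.+ rest ≡⟨ cong (λ u → u ℚ.* o ℚ.+ rest) (eval-p₀ _) ⟩
                1ℚ ℚ.* o ℚ.+ rest           ≡⟨ cong (ℚ._+ rest) (ℚ.*-identityˡ o) ⟩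
                o ℚ.+ rest                  ∎

          ord≡eval : ∀ {𝔡} → IsBasicSequence 𝔡 p → ∀ {S} → Admissible S → length S ≡ n →
            ∀ t → (∀ i → eval (Dpow 𝔡 i t) (w i) ≡ (if i ≡ᵇ n then ℕ→ℚ (n !) else 0ℚ)) →
            ℕ→ℚ (ord B S X z) ≡ eval t (ℕ→ℚ x)
          ord≡eval {𝔡} basic {S} adm refl t dual = trans (ord≡solution adm ℕ.≤-refl)
            (sym (interpolation {𝔡} {p} basic w (ℕ→ℚ x) G expansion n t dual))
            where
            expansion : ∀ m → eval (p m) (ℕ→ℚ x) ≡ subsetSum m (λ i j → eval (p j) (w i) ℚ.* G i)
            expansion m = begin
              h                                     ≡⟨ ℚ-cancel h rest ⟩
              (h ℚ.- rest) ℚ.+ rest                 ≡⟨ cong (ℚ._+ rest) (solution-rec total kernel m) ⟨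
              G m ℚ.+ rest                          ≡⟨ cong (ℚ._+ rest) (ℚ.*-identityˡ (G m)) ⟨
              1ℚ ℚ.* G m ℚ.+ rest                   ≡⟨ cong (λ u → u ℚ.* G m ℚ.+ rest) (eval-p₀ (w m)) ⟨
              eval (p 0) (w m) ℚ.* G m ℚ.+ rest     ≡⟨ subsetSum≡top+proper m (λ i j → kernel i j ℚ.* G i) ⟨
              subsetSum m (λ i j → eval (p j) (w i) ℚ.* G i) ∎
              where
              h = eval (p m) (ℕ→ℚ x)
              rest = properSubsetSum m (λ i j → eval (p j) (w i) ℚ.* G i)
              ℚ-cancel : ∀ a b → a ≡ a ℚ.- b ℚ.+ b
              ℚ-cancel = solve 2 (λ a b → a := (a :+ (:- b)) :+ b) refl

theorem5p2 : (B : BinomialClass) (p : ℕ → Poly) (𝔡 : DeltaOperator) →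
    HasCountingPolys B p → IsBasicSequence 𝔡 p →
    (n x : ℕ) → 1 ≤ x →
    (S : List ℕ) → IsFinSet S → length S ≡ n → Disjoint S (interval x) →
    (z : ℕ → ℚ) →
    (∀ i → i < n → ∃[ k ] (z i ≡ ℕ→ℚ k × 1 ≤ k × k ≤ x)) →
    (∀ i → suc i < n → z i ≤ℚ z (suc i)) →
    (∀ t → IsT 𝔡 (λ i → ℕ→ℚ x - z i) n t →
    ℕ→ℚ (ord B S (interval x) z) ≡ eval t (ℕ→ℚ x))
    × (∀ t → IsT 𝔡 (λ i → - z i) n t →
    ℕ→ℚ (ord B S (interval x) z) ≡ eval t 0ℚ)
theorem5p2 B p 𝔡 counting basic n x _ S finS lenS S∩X z z∈X z-mono =
  (λ t (_ , dual) → atX t dual) ,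
  (λ t (_ , dual) → trans
    -- The shifted polynomial is t(y - x): applying 𝔡ⁱ and evaluating at x - z i gives the value of
    -- 𝔡ⁱ t at - z i, so it satisfies the conditions of the first formula, and its value at x is
    -- t(0).
    (atX (shift (- ℕ→ℚ x) t) (λ i → trans (eval-Dpow-shift 𝔡 i (- ℕ→ℚ x) t _)
      (trans (cong (eval (Dpow 𝔡 i t)) (solve 2 (λ a b → (a :+ :- b) :+ (:- a) := :- b) refl (ℕ→ℚ x) (z i))) (dual i))))
    (trans (eval-shift (- ℕ→ℚ x) t (ℕ→ℚ x)) (cong (eval t) (ℚ.+-inverseʳ (ℕ→ℚ x)))))
  where
  bound : ∀ i → Dec (i < n) → ℕ
  bound i (yes i<n) = proj₁ (z∈X i i<n)
  bound i (no _) = x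

  -- Extended past n so that ζ is monotone and bounded by x everywhere.
  ζ : ℕ → ℕ
  ζ i = bound i (i ℕ.<? n)

  z≡ζ : ∀ i → i < n → z i ≡ ℕ→ℚ (ζ i)
  z≡ζ i i<n = z≡bound (i ℕ.<? n)
    where
    z≡bound : ∀ d → z i ≡ ℕ→ℚ (bound i d)
    z≡bound (yes i<n) = proj₁ (proj₂ (z∈X i i<n))
    z≡bound (no i≮n) = ⊥-elim (i≮n i<n)

  ζ≤x : ∀ i → ζ i ≤ x
  ζ≤x i = bound≤x (i ℕ.<? n)
    where
    bound≤x : ∀ d → bound i d ≤ x
    bound≤x (yes i<n) = proj₂ (proj₂ (proj₂ (z∈X i i<n)))
    bound≤x (no _) = ℕ.≤-refl

  ζ≡x : ∀ i → ¬ i < n → ζ i ≡ x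
  ζ≡x i i≮n = bound≡x (i ℕ.<? n)
    where
    bound≡x : ∀ d → bound i d ≡ x
    bound≡x (yes i<n) = ⊥-elim (i≮n i<n)
    bound≡x (no _) = refl

  ζ-step : ∀ i → ζ i ≤ ζ (suc i)
  ζ-step i = step (suc i ℕ.<? n)
    where
    step : Dec (suc i < n) → ζ i ≤ ζ (suc i)
    step (no ≮n) = subst (ζ i ≤_) (sym (ζ≡x (suc i) ≮n)) (ζ≤x i)
    step (yes <n) = ℕ.≤ᵇ⇒≤ _ _ (subst T (ℕ→ℚ-≤ᵇ (ζ i) (ζ (suc i)))
      (subst₂ (λ a b → T (a ℚ.≤ᵇ b)) (z≡ζ i (ℕ.<-trans (ℕ.n<1+n i) <n)) (z≡ζ (suc i) <n)
        (ℚ.≤⇒≤ᵇ (z-mono i <n))))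

  ζ-mono : ∀ {i j} → i ≤ j → ζ i ≤ ζ j
  ζ-mono i≤j = go (ℕ.≤⇒≤′ i≤j)
    where
    go : ∀ {i j} → i ℕ.≤′ j → ζ i ≤ ζ j
    go ℕ.≤′-refl = ℕ.≤-refl
    go (ℕ.≤′-step i≤j) = ℕ.≤-trans (go i≤j) (ζ-step _)

  open Class B {p} counting (proj₁ (proj₂ basic))
  open Target x using (_,_; module OrderStatistics)
  open OrderStatistics ζ-mono ζ≤x z≡ζ

  atX : ∀ t → (∀ i → eval (Dpow 𝔡 i t) (ℕ→ℚ x - z i) ≡ (if i ≡ᵇ n then ℕ→ℚ (n !) else 0ℚ)) →
    ℕ→ℚ (ord B S (interval x) z) ≡ eval t (ℕ→ℚ x)
  atX = ord≡eval (λ i → ℕ→ℚ x - z i)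
    (λ i i<n → trans (ℕ→ℚ-homo-∸ (ζ≤x i)) (cong (λ u → ℕ→ℚ x - u) (sym (z≡ζ i i<n))))
    basic (finS , S∩X) lenS
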